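{- Let $t\geq 1$. For every $C\geq 0$ there is an $n_0=n_0(t,C)$ with the following property. Suppose $G$ is a graph with $n\geq n_0$ vertices admitting a partition $V(G)=S_1\sqcup\cdots\sqcup S_t\sqcup X$ such that: for every $i$, every $v\in S_i$ and every $j\neq i$ we have $\deg(v,S_j)\geq |S_j|(1-\frac{\eta_t}{12})$; $|X|\leq C$; and $\frac{n}{t}(1-\alpha_t)\leq |S_i|\leq\frac{n}{t}(1+\alpha_t)$ for all $i$. If $G$ is $(2t-1)$-leveled, then $$|E(G)|\leq\frac{t-1}{2t}n^2+n.$$
   Context: Fix once and for all real constants $\eta_t,\alpha_t>0$ for $t=1,2,\dots$ satisfying $\eta_t<\frac{1}{100t}$ for all $t\geq1$, $\eta_t(1-2t\eta_t)^{ -1}<\eta_{t-1}$ for all $t\geq 2$, and $\alpha_t<\frac{\eta_t}{10t}$. All graphs are finite and simple. $\deg(v,Y)$ is the number of neighbours of $v$ in $Y\subseteq V(G)$. For a clique $\sigma$, $\mathrm{lk}_G\sigma$ is the subgraph induced on the vertices adjacent to every vertex of $\sigma$. For $d\geq0$, $G$ is $d$-leveled if (i) every maximal clique of $G$ has exactly $d+1$ vertices, and (ii) for every clique $\sigma$ with $d$ vertices, $\mathrm{lk}_G\sigma$ consists of exactly two non-adjacent vertices.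
   Formalization: The constants η_t and α_t are taken to be rational instead of real, and C is a natural number (which loses nothing, since |X| is an integer). -}

module Defs where

open import Data.Nat as ℕ using (ℕ; zero; suc; _<ᵇ_)
open import Data.Fin using (Fin; zero; suc; toℕ)
open import Data.Fin.Subset using (Subset; _∈_; _⊆_; ∣_∣)
open import Data.Bool using (Bool; true; false; if_then_else_; _∧_)
open import Data.Maybe using (Maybe; just; nothing)
open import Data.Product using (Σ; _×_; ∃-syntax)
open import Data.Sum using (_⊎_)
open import Data.Integer using (+_)
open import Data.Rational using (ℚ; _/_; _+_; _-_; _*_; _<_; 0ℚ; 1ℚ)
open import Relation.Binary.PropositionalEquality using (_≡_; _≢_)
open import Relation.Nullary using (¬_; does)
import Data.Fin
open import Function using (_∘_)

⟦_⟧ : ℕ → ℚ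
⟦ n ⟧ = + n / 1

record Graph (n : ℕ) : Set where
  field
    adj        : Fin n → Fin n → Bool
    adj-sym    : ∀ u v → adj u v ≡ adj v u
    adj-irrefl : ∀ v → adj v v ≡ false
open Graph public

countB : ∀ {n} → (Fin n → Bool) → ℕ
countB {zero}  f = 0
countB {suc n} f = (if f zero then 1 else 0) ℕ.+ countB (f ∘ suc)

sumF : ∀ {n} → (Fin n → ℕ) → ℕ
sumF {zero}  f = 0
sumF {suc n} f = f zero ℕ.+ sumF (f ∘ suc)

deg : ∀ {n} → Graph n → Fin n → (Fin n → Bool) → ℕ
deg G v Y = countB (λ u → adj G v u ∧ Y u)

numEdges : ∀ {n} → Graph n → ℕ
numEdges G = sumF (λ u → countB (λ v → adj G u v ∧ (toℕ u <ᵇ toℕ v)))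

IsClique : ∀ {n} → Graph n → Subset n → Set
IsClique G σ = ∀ u v → u ∈ σ → v ∈ σ → u ≢ v → adj G u v ≡ true

IsMaximalClique : ∀ {n} → Graph n → Subset n → Set
IsMaximalClique G σ = IsClique G σ × (∀ τ → IsClique G τ → σ ⊆ τ → τ ⊆ σ)

InLink : ∀ {n} → Graph n → Subset n → Fin n → Set
InLink G σ v = ∀ u → u ∈ σ → adj G u v ≡ true

Leveled : ∀ {n} → ℕ → Graph n → Set
Leveled {n} d G =
  (∀ σ → IsMaximalClique G σ → ∣ σ ∣ ≡ suc d) ×
  (∀ σ → IsClique G σ → ∣ σ ∣ ≡ d →
     Σ (Fin n) λ a → Σ (Fin n) λ b →
       a ≢ b × adj G a b ≡ false ×
       (∀ v → (InLink G σ v → (v ≡ a ⊎ v ≡ b)) × ((v ≡ a ⊎ v ≡ b) → InLink G σ v)))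

-- standing assumptions on the constants η_t, α_t (t ≥ 1; index 0 unused)
-- η_t (1 - 2tη_t)^{-1} < η_{t-1} is written multiplied out (1 - 2tη_t > 0 by η_t < 1/(100t)).
ConstantsOK : (ℕ → ℚ) → (ℕ → ℚ) → Set
ConstantsOK η α =
  (∀ t → 1 ℕ.≤ t →
     (0ℚ < η t) × (η t * ⟦ 100 ℕ.* t ⟧ < 1ℚ) ×
     (0ℚ < α t) × (α t * ⟦ 10 ℕ.* t ⟧ < η t)) ×
  (∀ t → 2 ℕ.≤ t → η t < η (t ℕ.∸ 1) * (1ℚ - ⟦ 2 ℕ.* t ⟧ * η t))

inS : ∀ {n t} → (Fin n → Maybe (Fin t)) → Fin t → Fin n → Bool
inS part j v with part v
... | nothing = false
... | just i  = does (i Data.Fin.≟ j)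

inX : ∀ {n t} → (Fin n → Maybe (Fin t)) → Fin n → Bool
inX part v with part v
... | nothing = true
... | just _  = false

{-# OPTIONS --safe #-}
-- Write 2t = d + 1.  If σ is a clique, A is an independent set inside lk σ, and Y contains the rest
-- of lk σ, then |A| ≤ 2|Y|^(d−|σ|): every v ∈ A has a neighbour in lk σ, which must lie in Y, so
-- A is covered by the links of the vertices of Y, and one inducts down to |σ| = d.
--
-- Applied with Y = X this shows that in a common neighbourhood of a clique outside S_j a large part
-- of S_j spans an edge.  Greedily choosing such edges gives cliques with two vertices in each of
-- several classes, and since cliques have at most 2t vertices:
--   * every vertex has a small neighbourhood in some class, so a vertex of X with degree about
--     (t−1)n/t behaves like a member of that class and can be moved into it;
--   * after the move, a vertex with three neighbours in its own class would extend to a clique on d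
--     vertices with those three neighbours in its link, so classes induce maximum degree at most 2.
-- The remaining vertices of X have degree at most (t−1)n/t − C, and the bound follows from
-- the convexity estimate (Σ|S_i|)² ≤ t Σ|S_i|² by counting.
module Submission where

open import Defs
open import Data.Nat as ℕ using (ℕ)
open import Data.Fin using (Fin)
open import Data.Maybe using (Maybe; just)
open import Data.Product using (_×_; _,_; proj₁; proj₂; ∃-syntax)
open import Data.Bool using (_∧_)
open import Relation.Binary.PropositionalEquality using (_≡_; _≢_; refl; sym; trans; cong; cong₂; subst₂)

module Combinatorics where

  open import Data.Nat using (zero; suc; _+_; _*_; _∸_; _^_; _≤_; _<_; z≤n; s≤s; _≤?_; _<ᵇ_)
  open import Data.Nat.Properties hiding (suc-injective; _≟_)
  open import Data.Nat.ListAction using (sum)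
  open import Data.Nat.ListAction.Properties using (sum-++)
  open import Data.Nat.Tactic.RingSolver using (solve-∀)
  open import Data.Fin using (zero; suc; toℕ; punchIn)
  import Data.Fin as Fin
  open import Data.Fin.Properties using (any?; suc-injective; toℕ-injective; punchIn-injective; punchInᵢ≢i)
  open import Data.Fin.Subset as Subset using (Subset; _∈_; _∉_; _⊆_; ∣_∣; ⁅_⁆; _∪_; inside; outside)
  open import Data.Fin.Subset.Properties using (_∈?_; ∣p∣≤n; ∣⊥∣≡0; x∈p∪q⁻; x∈p∪q⁺; x∈⁅x⁆; x∈⁅y⁆⇒x≡y; ∉⊥; ∪-identityˡ)
  open import Data.Vec using (_∷_; here; there)
  open import Data.Bool using (Bool; true; false; if_then_else_; _∨_; not)
  open import Data.Bool.Properties using (∧-conicalˡ; ∧-conicalʳ; ¬-not; ∨-zeroʳ)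
  import Data.Bool as Bool
  open import Data.Empty using (⊥; ⊥-elim)
  open import Data.Maybe using (nothing)
  open import Data.Maybe.Properties using (just-injective)
  open import Data.Product using (Σ; ∃)
  open import Data.Sum using (_⊎_; inj₁; inj₂)
  open import Data.List as List using (List; []; _∷_; length; map; _++_; allFin)
  open import Data.List.Properties using (++-assoc; ++-identityʳ; length-++; length-map; length-tabulate; map-++)
  import Data.List.Membership.Propositional as L
  open import Data.List.Relation.Unary.Any using (here; there)
  open import Data.List.Relation.Unary.All as All using (All; []; _∷_)
  import Data.List.Relation.Unary.All.Properties as All
  open import Data.List.Relation.Unary.AllPairs as AllPairs using (AllPairs; []; _∷_)
  import Data.List.Relation.Unary.AllPairs.Properties as AllPairs
  open import Data.List.Relation.Unary.Unique.Propositional using (Unique)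
  import Data.List.Relation.Unary.Unique.Propositional.Properties as Unique
  open import Relation.Binary.PropositionalEquality using (subst; module ≡-Reasoning)
  open import Relation.Nullary using (¬_; does; yes; no; contradiction)
  open import Function using (_∘_)

  -- Finite sums and cardinalities of Boolean predicates on `Fin n`.

  ∧-true : ∀ {a b} → a ≡ true → b ≡ true → a ∧ b ≡ true
  ∧-true refl refl = refl

  ind : Bool → ℕ
  ind b = if b then 1 else 0

  sumF-cong : ∀ {n} {f g : Fin n → ℕ} → (∀ i → f i ≡ g i) → sumF f ≡ sumF g
  sumF-cong {zero}  h = refl
  sumF-cong {suc n} h = cong₂ _+_ (h zero) (sumF-cong (h ∘ suc))

  sumF-mono : ∀ {n} {f g : Fin n → ℕ} → (∀ i → f i ≤ g i) → sumF f ≤ sumF g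
  sumF-mono {zero}  h = z≤n
  sumF-mono {suc n} h = +-mono-≤ (h zero) (sumF-mono (h ∘ suc))

  sumF-+ : ∀ {n} (f g : Fin n → ℕ) → sumF (λ i → f i + g i) ≡ sumF f + sumF g
  sumF-+ {zero}  f g = refl
  sumF-+ {suc n} f g = begin
    f zero + g zero + sumF (λ i → f (suc i) + g (suc i)) ≡⟨ cong (f zero + g zero +_) (sumF-+ (f ∘ suc) (g ∘ suc)) ⟩
    f zero + g zero + (sumF (f ∘ suc) + sumF (g ∘ suc))  ≡⟨ +-assoc (f zero) (g zero) _ ⟩
    f zero + (g zero + (sumF (f ∘ suc) + sumF (g ∘ suc))) ≡⟨ cong (f zero +_) (+-comm (g zero) _) ⟩
    f zero + (sumF (f ∘ suc) + sumF (g ∘ suc) + g zero)  ≡⟨ cong (f zero +_) (+-assoc (sumF (f ∘ suc)) _ _) ⟩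
    f zero + (sumF (f ∘ suc) + (sumF (g ∘ suc) + g zero)) ≡⟨ sym (+-assoc (f zero) _ _) ⟩
    f zero + sumF (f ∘ suc) + (sumF (g ∘ suc) + g zero)  ≡⟨ cong (f zero + sumF (f ∘ suc) +_) (+-comm _ (g zero)) ⟩
    f zero + sumF (f ∘ suc) + (g zero + sumF (g ∘ suc))  ∎
    where open ≡-Reasoning

  sumF-0 : ∀ n → sumF {n} (λ _ → 0) ≡ 0
  sumF-0 zero    = refl
  sumF-0 (suc n) = sumF-0 n

  sumF-const : ∀ n c → sumF {n} (λ _ → c) ≡ n * c
  sumF-const zero    c = refl
  sumF-const (suc n) c = cong (c +_) (sumF-const n c)

  sumF-*ˡ : ∀ {n} c (f : Fin n → ℕ) → sumF (λ i → c * f i) ≡ c * sumF f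
  sumF-*ˡ {zero}  c f = sym (*-zeroʳ c)
  sumF-*ˡ {suc n} c f = trans (cong (c * f zero +_) (sumF-*ˡ c (f ∘ suc))) (sym (*-distribˡ-+ c (f zero) _))

  sumF-*ʳ : ∀ {n} (f : Fin n → ℕ) c → sumF (λ i → f i * c) ≡ sumF f * c
  sumF-*ʳ {zero}  f c = refl
  sumF-*ʳ {suc n} f c = trans (cong (f zero * c +_) (sumF-*ʳ (f ∘ suc) c)) (sym (*-distribʳ-+ c (f zero) _))

  sumF-swap : ∀ {m n} (f : Fin m → Fin n → ℕ) →
    sumF (λ i → sumF (f i)) ≡ sumF (λ j → sumF (λ i → f i j))
  sumF-swap {zero}  {n} f = sym (sumF-0 n)
  sumF-swap {suc m} f = trans (cong (sumF (f zero) +_) (sumF-swap (f ∘ suc)))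
    (sym (sumF-+ (f zero) (λ j → sumF (λ i → f (suc i) j))))

  count≡sum : ∀ {n} (f : Fin n → Bool) → countB f ≡ sumF (ind ∘ f)
  count≡sum {zero}  f = refl
  count≡sum {suc n} f = cong (ind (f zero) +_) (count≡sum (f ∘ suc))

  ind-mono : ∀ {a b} → (a ≡ true → b ≡ true) → ind a ≤ ind b
  ind-mono {false} h = z≤n
  ind-mono {true}  h rewrite h refl = s≤s z≤n

  count-mono : ∀ {n} {f g : Fin n → Bool} → (∀ v → f v ≡ true → g v ≡ true) → countB f ≤ countB g
  count-mono {zero}  h = z≤n
  count-mono {suc n} h = +-mono-≤ (ind-mono (h zero)) (count-mono (h ∘ suc))

  ind-split : ∀ {a b c} → (a ≡ true → b ≡ true ⊎ c ≡ true) → ind a ≤ ind b + ind c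
  ind-split {false} h = z≤n
  ind-split {true} {b} {c} h with h refl
  ... | inj₁ refl = s≤s z≤n
  ... | inj₂ refl = m≤n+m 1 (ind b)

  count-split : ∀ {n} {f g h : Fin n → Bool} →
    (∀ v → f v ≡ true → g v ≡ true ⊎ h v ≡ true) → countB f ≤ countB g + countB h
  count-split {f = f} {g} {h} p = begin
    countB f ≡⟨ count≡sum f ⟩
    sumF (ind ∘ f) ≤⟨ sumF-mono (λ v → ind-split (p v)) ⟩
    sumF (λ v → ind (g v) + ind (h v)) ≡⟨ sumF-+ (ind ∘ g) (ind ∘ h) ⟩
    sumF (ind ∘ g) + sumF (ind ∘ h) ≡⟨ cong₂ _+_ (count≡sum g) (count≡sum h) ⟨
    countB g + countB h ∎
    where open ≤-Reasoning

  ind-∧-not : ∀ a b → ind (a ∧ b) + ind (a ∧ not b) ≡ ind a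
  ind-∧-not false b     = refl
  ind-∧-not true  false = refl
  ind-∧-not true  true  = refl

  count-∧-not : ∀ {n} (f g : Fin n → Bool) →
    countB (λ v → f v ∧ g v) + countB (λ v → f v ∧ not (g v)) ≡ countB f
  count-∧-not f g = begin
    countB (λ v → f v ∧ g v) + countB (λ v → f v ∧ not (g v))
      ≡⟨ cong₂ _+_ (count≡sum (λ v → f v ∧ g v)) (count≡sum (λ v → f v ∧ not (g v))) ⟩
    sumF (λ v → ind (f v ∧ g v)) + sumF (λ v → ind (f v ∧ not (g v)))
      ≡⟨ sumF-+ (λ v → ind (f v ∧ g v)) (λ v → ind (f v ∧ not (g v))) ⟨
    sumF (λ v → ind (f v ∧ g v) + ind (f v ∧ not (g v)))
      ≡⟨ sumF-cong (λ v → ind-∧-not (f v) (g v)) ⟩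
    sumF (ind ∘ f)
      ≡⟨ count≡sum f ⟨
    countB f ∎
    where open ≡-Reasoning

  1≤count : ∀ {n} {f : Fin n → Bool} {v} → f v ≡ true → 1 ≤ countB f
  1≤count {f = f} {zero}  h rewrite h = s≤s z≤n
  1≤count {f = f} {suc v} h = ≤-trans (1≤count {f = f ∘ suc} h) (m≤n+m _ (ind (f zero)))

  count-none : ∀ {n} {f : Fin n → Bool} → (∀ v → f v ≡ false) → countB f ≡ 0
  count-none {zero}  h = refl
  count-none {suc n} {f} h rewrite h zero = count-none {f = f ∘ suc} (h ∘ suc)

  count-≟ : ∀ {n} (a : Fin n) → countB (λ v → does (v Fin.≟ a)) ≡ 1
  count-≟ {suc n} zero = cong suc (count-none {n} (λ _ → refl))
  count-≟ (suc a)      = count-≟ a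

  count-pair : ∀ {n} {f : Fin n → Bool} (a b : Fin n) →
    (∀ v → f v ≡ true → v ≡ a ⊎ v ≡ b) → countB f ≤ 2
  count-pair {f = f} a b h = subst (countB f ≤_) (cong₂ _+_ (count-≟ a) (count-≟ b)) (count-split λ v p → aux v (h v p))
    where
    aux : ∀ v → v ≡ a ⊎ v ≡ b → does (v Fin.≟ a) ≡ true ⊎ does (v Fin.≟ b) ≡ true
    aux v (inj₁ refl) with v Fin.≟ v
    ... | yes _ = inj₁ refl
    ... | no ¬p = contradiction refl ¬p
    aux v (inj₂ refl) with v Fin.≟ v
    ... | yes _ = inj₂ refl
    ... | no ¬p = contradiction refl ¬p

  -- Double counting of the pairs `(v , y)` with `A v`, `Y y` and `R y v`: every `v` in `A` occurs
  -- in at least one of them, every `y` in `Y` in at most `K`.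
  count-cover : ∀ {n} {A Y : Fin n → Bool} {R : Fin n → Fin n → Bool} {K} →
    (∀ v → A v ≡ true → ∃ λ y → Y y ≡ true × R y v ≡ true) →
    (∀ y → Y y ≡ true → countB (λ v → A v ∧ R y v) ≤ K) →
    countB A ≤ countB Y * K
  count-cover {n} {A = A} {Y} {R} {K} cov bnd = begin
    countB A ≡⟨ count≡sum A ⟩
    sumF (ind ∘ A) ≤⟨ sumF-mono lower ⟩
    sumF (λ v → sumF (λ y → ind (Y y ∧ (A v ∧ R y v)))) ≡⟨ sumF-swap (λ v y → ind (Y y ∧ (A v ∧ R y v))) ⟩
    sumF (λ y → sumF (λ v → ind (Y y ∧ (A v ∧ R y v)))) ≤⟨ sumF-mono upper ⟩
    sumF (λ y → ind (Y y) * K) ≡⟨ sumF-*ʳ (ind ∘ Y) K ⟩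
    sumF (ind ∘ Y) * K ≡⟨ cong (_* K) (count≡sum Y) ⟨
    countB Y * K ∎
    where
    open ≤-Reasoning
    lower : ∀ v → ind (A v) ≤ sumF (λ y → ind (Y y ∧ (A v ∧ R y v)))
    lower v with A v in eq
    ... | false = z≤n
    ... | true  = let y , p , q = cov v eq in
      subst (1 ≤_) (count≡sum (λ y → Y y ∧ R y v)) (1≤count {v = y} (∧-true p q))
    upper : ∀ y → sumF (λ v → ind (Y y ∧ (A v ∧ R y v))) ≤ ind (Y y) * K
    upper y with Y y in eq
    ... | false = ≤-reflexive (sumF-0 n)
    ... | true  = ≤-trans (≤-reflexive (sym (count≡sum (λ v → A v ∧ R y v))))
                    (≤-trans (bnd y eq) (≤-reflexive (sym (+-identityʳ K))))

  count-witnesses : ∀ {n} (f : Fin n → Bool) →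
    Σ (List (Fin n)) λ vs → length vs ≡ countB f × All (λ v → f v ≡ true) vs × AllPairs _≢_ vs
  count-witnesses {zero}  f = [] , refl , [] , []
  count-witnesses {suc n} f with count-witnesses (f ∘ suc) | f zero in eq
  ... | vs , len , tr , un | false =
    map suc vs , trans (length-map suc vs) len , All.map⁺ tr ,
    AllPairs.map⁺ (AllPairs.map (λ ne → ne ∘ suc-injective) un)
  ... | vs , len , tr , un | true  =
    zero ∷ map suc vs , cong suc (trans (length-map suc vs) len) , eq ∷ All.map⁺ tr ,
    All.map⁺ (All.universal (λ _ ()) vs) ∷ AllPairs.map⁺ (AllPairs.map (λ ne → ne ∘ suc-injective) un)

  count≤2 : ∀ {n} (f : Fin n → Bool) →
    (∀ a b c → a ≢ b → a ≢ c → b ≢ c → f a ≡ true → f b ≡ true → ¬ f c ≡ true) → countB f ≤ 2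
  count≤2 f h with count-witnesses f
  ... | [] , len , _ = subst (_≤ 2) len z≤n
  ... | a ∷ [] , len , _ = subst (_≤ 2) len (s≤s z≤n)
  ... | a ∷ b ∷ [] , len , _ = subst (_≤ 2) len (s≤s (s≤s z≤n))
  ... | a ∷ b ∷ c ∷ _ , _ , (pa ∷ pb ∷ pc ∷ _) , ((ab ∷ ac ∷ _) ∷ (bc ∷ _) ∷ _) =
    contradiction pc (h a b c ab ac bc pa pb)

  -- Cliques and links, with vertex sets given as lists.

  Clique : ∀ {n} → Graph n → List (Fin n) → Set
  Clique G = AllPairs (λ u v → adj G u v ≡ true)

  lk : ∀ {n} → Graph n → List (Fin n) → Fin n → Bool
  lk G []      v = true
  lk G (u ∷ σ) v = adj G u v ∧ lk G σ v

  lk⁻ : ∀ {n} (G : Graph n) {σ v} → lk G σ v ≡ true → All (λ u → adj G u v ≡ true) σ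
  lk⁻ G {[]}    h = []
  lk⁻ G {u ∷ σ} h = ∧-conicalˡ _ _ h ∷ lk⁻ G (∧-conicalʳ _ _ h)

  lk⁺ : ∀ {n} (G : Graph n) {σ v} → All (λ u → adj G u v ≡ true) σ → lk G σ v ≡ true
  lk⁺ G []       = refl
  lk⁺ G (p ∷ ps) = ∧-true p (lk⁺ G ps)

  clique-∷ : ∀ {n} (G : Graph n) {σ v} → Clique G σ → lk G σ v ≡ true → Clique G (v ∷ σ)
  clique-∷ G cl h = All.map (λ {u} p → trans (adj-sym G _ u) p) (lk⁻ G h) ∷ cl

  nonNbrs : ∀ {n} → Graph n → (Fin n → Bool) → Fin n → ℕ
  nonNbrs G S u = countB (λ v → S v ∧ not (adj G u v))

  module _ {n} (G : Graph n) (S : Fin n → Bool) where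

    -- A union bound: what `S` loses on passing from the link of `β` to that of `ρ ++ β` consists of
    -- non-neighbours of vertices of `ρ`.
    count-lk-++ : ∀ ρ β → countB (λ v → S v ∧ lk G β v) ≤
      countB (λ v → S v ∧ lk G (ρ ++ β) v) + sum (map (nonNbrs G S) ρ)
    count-lk-++ []      β = m≤m+n _ 0
    count-lk-++ (u ∷ ρ) β = begin
      countB (λ v → S v ∧ lk G β v)
        ≤⟨ count-lk-++ ρ β ⟩
      countB (λ v → S v ∧ lk G (ρ ++ β) v) + sum (map (nonNbrs G S) ρ)
        ≤⟨ +-monoˡ-≤ _ (count-split step) ⟩
      c + nonNbrs G S u + sum (map (nonNbrs G S) ρ)
        ≡⟨ +-assoc c _ _ ⟩
      c + (nonNbrs G S u + sum (map (nonNbrs G S) ρ)) ∎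
      where
      open ≤-Reasoning
      c = countB (λ v → S v ∧ lk G (u ∷ ρ ++ β) v)
      step : ∀ v → S v ∧ lk G (ρ ++ β) v ≡ true →
        S v ∧ lk G (u ∷ ρ ++ β) v ≡ true ⊎ S v ∧ not (adj G u v) ≡ true
      step v h with S v | adj G u v
      ... | true | true  = inj₁ h
      ... | true | false = inj₂ refl

  sum-bound : ∀ {A : Set} {c s} (f : A → ℕ) {xs} →
    All (λ x → c * f x ≤ s) xs → c * sum (map f xs) ≤ length xs * s
  sum-bound {c = c} f []       = ≤-reflexive (*-zeroʳ c)
  sum-bound {c = c} f (p ∷ ps) =
    ≤-trans (≤-reflexive (*-distribˡ-+ c _ _)) (+-mono-≤ p (sum-bound {c = c} f ps))

  -- Cliques are kept as lists because they are built vertex by vertex; this map passes to the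
  -- subsets that `Leveled` speaks of. Since `adj` is irreflexive, the entries of a clique are
  -- distinct and its length is its cardinality.
  fromList : ∀ {n} → List (Fin n) → Subset n
  fromList = List.foldr (λ v s → ⁅ v ⁆ ∪ s) Subset.⊥

  ∈-fromList⁻ : ∀ {n} (σ : List (Fin n)) {v} → v ∈ fromList σ → v L.∈ σ
  ∈-fromList⁻ []      h = contradiction h ∉⊥
  ∈-fromList⁻ (u ∷ σ) h with x∈p∪q⁻ ⁅ u ⁆ _ h
  ... | inj₁ p = here (x∈⁅y⁆⇒x≡y u p)
  ... | inj₂ q = there (∈-fromList⁻ σ q)

  ∈-fromList⁺ : ∀ {n} {σ : List (Fin n)} {v} → v L.∈ σ → v ∈ fromList σ
  ∈-fromList⁺ (here refl) = x∈p∪q⁺ (inj₁ (x∈⁅x⁆ _))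
  ∈-fromList⁺ (there q)   = x∈p∪q⁺ (inj₂ (∈-fromList⁺ q))

  ∣⁅x⁆∪p∣ : ∀ {n} {x : Fin n} {p} → x ∉ p → ∣ ⁅ x ⁆ ∪ p ∣ ≡ suc ∣ p ∣
  ∣⁅x⁆∪p∣ {x = zero}  {inside  ∷ p} h = contradiction here h
  ∣⁅x⁆∪p∣ {x = zero}  {outside ∷ p} h = cong suc (cong ∣_∣ (∪-identityˡ p))
  ∣⁅x⁆∪p∣ {x = suc x} {inside  ∷ p} h = cong suc (∣⁅x⁆∪p∣ (h ∘ there))
  ∣⁅x⁆∪p∣ {x = suc x} {outside ∷ p} h = ∣⁅x⁆∪p∣ (h ∘ there)

  -- Cliques in leveled graphs.

  module _ {n} (G : Graph n) where

    clique-irrefl : ∀ {v u} → adj G v u ≡ true → v ≢ u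
    clique-irrefl {v} h refl with trans (sym h) (adj-irrefl G v)
    ... | ()

    ∣fromList∣ : ∀ {σ} → Clique G σ → ∣ fromList σ ∣ ≡ length σ
    ∣fromList∣ []       = ∣⊥∣≡0 n
    ∣fromList∣ {v ∷ σ} (p ∷ cl) = trans
      (∣⁅x⁆∪p∣ (λ h → clique-irrefl (All.lookup p (∈-fromList⁻ σ h)) refl))
      (cong suc (∣fromList∣ cl))

    clique-adj : ∀ {σ} → Clique G σ → ∀ {u v} → u L.∈ σ → v L.∈ σ → u ≢ v → adj G u v ≡ true
    clique-adj (p ∷ cl) (here refl) (here refl) ne = contradiction refl ne
    clique-adj (p ∷ cl) (here refl) (there b)   ne = All.lookup p b
    clique-adj (p ∷ cl) (there a)   (here refl) ne = trans (adj-sym G _ _) (All.lookup p a)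
    clique-adj (p ∷ cl) (there a)   (there b)   ne = clique-adj cl a b ne

    fromList-clique : ∀ {σ} → Clique G σ → IsClique G (fromList σ)
    fromList-clique {σ} cl u v a b = clique-adj cl (∈-fromList⁻ σ a) (∈-fromList⁻ σ b)

    search : (f : Fin n → Bool) → (∃ λ v → f v ≡ true) ⊎ (∀ v → ¬ f v ≡ true)
    search f with any? (λ v → f v Bool.≟ true)
    ... | yes p = inj₁ p
    ... | no ¬p = inj₂ (λ v h → ¬p (v , h))

    module LeveledGraph {d} (lev : Leveled d G) where

      -- With an empty link, `fromList σ` would be a maximal clique of the wrong size.
      extend : ∀ {σ} → Clique G σ → length σ ≢ suc d → ∃ λ v → lk G σ v ≡ true
      extend {σ} cl ne with search (lk G σ)
      ... | inj₁ p = p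
      ... | inj₂ none = contradiction
        (trans (sym (∣fromList∣ cl)) (proj₁ lev (fromList σ) (fromList-clique cl , maximal))) ne
        where
        maximal : ∀ τ → IsClique G τ → fromList σ ⊆ τ → τ ⊆ fromList σ
        maximal τ clτ σ⊆τ {v} v∈τ with v ∈? fromList σ
        ... | yes p = p
        ... | no ¬p = contradiction
          (lk⁺ G {σ} (All.tabulate λ {u} u∈σ →
            clτ u v (σ⊆τ (∈-fromList⁺ u∈σ)) v∈τ (λ { refl → ¬p (∈-fromList⁺ u∈σ) })))
          (none v)

      -- A clique that has passed the size `suc d` can be extended again and again and would end up
      -- with more than `n` vertices. The number `k` of further rounds satisfies `n ≤ k + length σ`.
      length≤ : ∀ {σ} → Clique G σ → length σ ≤ suc d
      length≤ {σ} cl = ≮⇒≥ λ lt → grow n cl lt (m≤m+n n _)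
        where
        grow : ∀ k {σ} → Clique G σ → suc d < length σ → ¬ n ≤ k + length σ
        grow k {σ} cl lt h with extend cl (>⇒≢ lt)
        grow zero    {σ} cl lt h | v , p = <⇒≱ (s≤s h)
          (subst (_≤ n) (∣fromList∣ (clique-∷ G cl p)) (∣p∣≤n (fromList (v ∷ σ))))
        grow (suc k) {σ} cl lt h | v , p =
          grow k (clique-∷ G cl p) (m<n⇒m<1+n lt) (subst (n ≤_) (sym (+-suc k (length σ))) h)

      -- Vertices of `Z` are added as long as the link contains one. By `length≤` this stops within
      -- `suc d` rounds.
      saturate : ∀ (Z : Fin n → Bool) {σ} → Clique G σ → Σ (List (Fin n)) λ ρ →
        Clique G (ρ ++ σ) × All (λ v → Z v ≡ true) ρ ×
        (∀ v → lk G (ρ ++ σ) v ≡ true → ¬ Z v ≡ true)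
      saturate Z {σ} cl = go (suc d) [] cl [] (m≤m+n _ _)
        where
        go : ∀ k ρ → Clique G (ρ ++ σ) → All (λ v → Z v ≡ true) ρ →
          suc d ≤ k + length (ρ ++ σ) → Σ (List (Fin n)) λ ρ →
          Clique G (ρ ++ σ) × All (λ v → Z v ≡ true) ρ ×
          (∀ v → lk G (ρ ++ σ) v ≡ true → ¬ Z v ≡ true)
        go k ρ cl z h with search (λ v → lk G (ρ ++ σ) v ∧ Z v)
        go k ρ cl z h | inj₂ none = ρ , cl , z , λ v p q → none v (∧-true p q)
        go zero ρ cl z h | inj₁ (v , p) =
          contradiction (length≤ (clique-∷ G cl (∧-conicalˡ _ _ p))) (<⇒≱ (s≤s h))
        go (suc k) ρ cl z h | inj₁ (v , p) =
          go k (v ∷ ρ) (clique-∷ G cl (∧-conicalˡ _ _ p)) (∧-conicalʳ _ _ p ∷ z)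
            (subst (suc d ≤_) (sym (+-suc k _)) h)

      link-pair : ∀ {σ} → Clique G σ → length σ ≡ d →
        ∃ λ a → ∃ λ b → ∀ v → lk G σ v ≡ true → v ≡ a ⊎ v ≡ b
      link-pair {σ} cl len =
        let a , b , _ , _ , h = proj₂ lev (fromList σ) (fromList-clique cl) (trans (∣fromList∣ cl) len) in
        a , b , λ v p → proj₁ (h v) λ u u∈σ → All.lookup (lk⁻ G {σ} p) (∈-fromList⁻ σ u∈σ)

      independent≤ : ∀ e {σ} (A Y : Fin n → Bool) → Clique G σ → length σ + e ≡ d →
        (∀ v → A v ≡ true → lk G σ v ≡ true) →
        (∀ u v → A u ≡ true → A v ≡ true → ¬ adj G u v ≡ true) →
        (∀ v → lk G σ v ≡ true → A v ≡ true ⊎ Y v ≡ true) →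
        countB A ≤ 2 * countB Y ^ e
      independent≤ zero {σ} A Y cl len A⊆ ind cov =
        let a , b , h = link-pair cl (trans (sym (+-identityʳ _)) len) in
        count-pair {f = A} a b λ v p → h v (A⊆ v p)
      independent≤ (suc e) {σ} A Y cl len A⊆ ind cov = begin
        countB A
          ≤⟨ count-cover {A = A} {Y = λ y → Y y ∧ lk G σ y} {R = adj G} cover fibre ⟩
        countB (λ y → Y y ∧ lk G σ y) * (2 * countB Y ^ e)
          ≤⟨ *-monoˡ-≤ (2 * countB Y ^ e) (count-mono {f = λ y → Y y ∧ lk G σ y} {g = Y} (λ y → ∧-conicalˡ (Y y) (lk G σ y))) ⟩
        countB Y * (2 * countB Y ^ e)
          ≡⟨ *-assoc (countB Y) 2 _ ⟨
        countB Y * 2 * countB Y ^ e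
          ≡⟨ cong (_* countB Y ^ e) (*-comm (countB Y) 2) ⟩
        2 * countB Y * countB Y ^ e
          ≡⟨ *-assoc 2 (countB Y) _ ⟩
        2 * countB Y ^ suc e ∎
        where
        open ≤-Reasoning
        len′ : suc (length σ + e) ≡ d
        len′ = trans (sym (+-suc _ e)) len
        cover : ∀ v → A v ≡ true → ∃ λ y → (Y y ∧ lk G σ y ≡ true) × adj G y v ≡ true
        -- `v ∷ σ` has at most `d` vertices, so it extends; independence keeps the new vertex `y`
        -- out of `A`, hence `y` is in `Y`.
        cover v a with extend (clique-∷ G cl (A⊆ v a))
                         (<⇒≢ (s≤s (≤-trans (s≤s (m≤m+n (length σ) e)) (≤-reflexive len′))))
        ... | y , p with ∧-conicalˡ _ _ p | ∧-conicalʳ (adj G v y) _ p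
        ... | vy | q with cov y q
        ... | inj₁ ay = contradiction vy (ind v y a ay)
        ... | inj₂ yy = y , ∧-true yy q , trans (adj-sym G y v) vy
        fibre : ∀ y → Y y ∧ lk G σ y ≡ true → countB (λ v → A v ∧ adj G y v) ≤ 2 * countB Y ^ e
        -- The fibre is an independent set in the link of `y ∷ σ`, and the same `Y` covers the rest
        -- of that smaller link.
        fibre y p = independent≤ e (λ v → A v ∧ adj G y v) Y
          (clique-∷ G cl (∧-conicalʳ _ _ p)) len′
          (λ v q → ∧-true (∧-conicalʳ _ _ q) (A⊆ v (∧-conicalˡ _ _ q)))
          (λ u v qu qv → ind u v (∧-conicalˡ _ _ qu) (∧-conicalˡ _ _ qv))
          cov′
          where
          cov′ : ∀ v → adj G y v ∧ lk G σ v ≡ true → A v ∧ adj G y v ≡ true ⊎ Y v ≡ true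
          cov′ v q with cov v (∧-conicalʳ _ _ q)
          ... | inj₁ av = inj₁ (∧-true av (∧-conicalˡ _ _ q))
          ... | inj₂ yv = inj₂ yv

  -- Membership in the classes of the partition.

  module _ {n t} (part : Fin n → Maybe (Fin t)) where

    -- The vertices with which cliques get saturated: a link containing none of them lies in the
    -- union of `S j` and `X`.
    elsewhere : Fin t → Fin n → Bool
    elsewhere j v = not (inX part v) ∧ not (inS part j v)

    elsewhere⁻ : ∀ j v → elsewhere j v ≡ true → ∃ λ i → part v ≡ just i × i ≢ j
    elsewhere⁻ j v h with part v
    ... | just i with i Fin.≟ j
    elsewhere⁻ j v () | just i | yes _
    ... | no ne = i , refl , ne

    elsewhere⁺ : ∀ {j v i} → part v ≡ just i → i ≢ j → elsewhere j v ≡ true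
    elsewhere⁺ {j} {v} {i} eq ne with part v
    elsewhere⁺ {j} {v} {i} refl ne | just i with i Fin.≟ j
    ... | yes p = contradiction p ne
    ... | no _  = refl

    ¬elsewhere : ∀ j v → ¬ elsewhere j v ≡ true → inS part j v ≡ true ⊎ inX part v ≡ true
    ¬elsewhere j v h with part v
    ... | nothing = inj₂ refl
    ... | just i with i Fin.≟ j
    ... | yes _ = inj₁ refl
    ... | no _  = contradiction refl h

    inS⁻ : ∀ j v → inS part j v ≡ true → part v ≡ just j
    inS⁻ j v h with part v
    ... | just i with i Fin.≟ j
    inS⁻ j v h | just i | yes refl = refl
    inS⁻ j v () | just i | no _

    inS-elsewhere : ∀ {i j v} → inS part i v ≡ true → i ≢ j → elsewhere j v ≡ true
    inS-elsewhere {i} {v = v} h = elsewhere⁺ (inS⁻ i v h)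

  -- Edges inside links and the greedy construction of cliques.

  module _ {n} (G : Graph n) where

    HasEdge : (Fin n → Bool) → Set
    HasEdge f = ∃ λ a → ∃ λ b → f a ≡ true × f b ≡ true × adj G a b ≡ true

    hasEdge? : ∀ f → HasEdge f ⊎ (∀ u v → f u ≡ true → f v ≡ true → ¬ adj G u v ≡ true)
    hasEdge? f with any? (λ a → any? (λ b → (f a ∧ (f b ∧ adj G a b)) Bool.≟ true))
    ... | yes (a , b , h) = inj₁ (a , b , ∧-conicalˡ _ _ h ,
            ∧-conicalˡ _ _ (∧-conicalʳ (f a) _ h) , ∧-conicalʳ (f b) _ (∧-conicalʳ (f a) _ h))
    ... | no ¬p = inj₂ λ u v fu fv uv → ¬p (u , v , ∧-true fu (∧-true fv uv))

    hasEdge-mono : ∀ {f g} → (∀ v → f v ≡ true → g v ≡ true) → HasEdge f → HasEdge g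
    hasEdge-mono h (a , b , fa , fb , ab) = a , b , h a fa , h b fb , ab

    clique-edge : ∀ {σ f} → Clique G σ → (e : HasEdge f) →
      (∀ v → f v ≡ true → lk G σ v ≡ true) → Clique G (proj₁ e ∷ proj₁ (proj₂ e) ∷ σ)
    clique-edge {σ} cl (a , b , fa , fb , ab) h =
      clique-∷ G (clique-∷ G cl (h b fb)) (∧-true (trans (adj-sym G b a) ab) (h a fa))

    -- `D j` is the part of class `j` from which its edge may be chosen. Each edge is taken in the
    -- link of the clique built so far, so every class in `L` contributes two vertices.
    greedy : ∀ {t} (D : Fin t → Fin n → Bool) L → Unique L →
      All (λ j → ∀ ρ → Clique G ρ → All (λ v → ∃ λ k → k ≢ j × D k v ≡ true) ρ →
             HasEdge (λ v → D j v ∧ lk G ρ v)) L →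
      ∃ λ ρ → Clique G ρ × length ρ ≡ 2 * length L × All (λ v → ∃ λ k → k L.∈ L × D k v ≡ true) ρ
    greedy D []      un h = [] , [] , refl , []
    greedy D (j ∷ L) (j∉ ∷ un) (hj ∷ h) with greedy D L un h
    ... | ρ , cl , len , ps with hj ρ cl (All.map (λ (k , k∈ , p) → k , (λ { refl → All.lookup j∉ k∈ refl }) , p) ps)
    -- As `L` has no repetitions, all vertices found so far come from some `D k` with `k ≢ j`, which
    -- is what the hypothesis for `j` asks of them.
    ... | e@(a , b , fa , fb , ab) =
      a ∷ b ∷ ρ , clique-edge cl e (λ v → ∧-conicalʳ (D j v) _) ,
      trans (cong (2 +_) len) (sym (*-suc 2 (length L))) ,
      (j , here refl , ∧-conicalˡ _ _ fa) ∷ (j , here refl , ∧-conicalˡ _ _ fb) ∷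
      All.map (λ (k , k∈ , p) → k , there k∈ , p) ps

    count-lk : ∀ S ρ → countB S ≤ countB (λ v → S v ∧ lk G ρ v) + sum (map (nonNbrs G S) ρ)
    count-lk S ρ = begin
      countB S ≤⟨ count-mono {f = S} (λ v p → ∧-true p refl) ⟩
      countB (λ v → S v ∧ true) ≤⟨ count-lk-++ G S ρ [] ⟩
      countB (λ v → S v ∧ lk G (ρ ++ []) v) + sum (map (nonNbrs G S) ρ)
        ≡⟨ cong (λ σ → countB (λ v → S v ∧ lk G σ v) + sum (map (nonNbrs G S) ρ)) (++-identityʳ ρ) ⟩
      countB (λ v → S v ∧ lk G ρ v) + sum (map (nonNbrs G S) ρ) ∎
      where open ≤-Reasoning

  -- Enumeration of the remaining classes, and numerical estimates.

  others : ∀ {t} → Fin (suc t) → List (Fin (suc t))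
  others {t} i = map (punchIn i) (allFin t)

  others-unique : ∀ {t} (i : Fin (suc t)) → Unique (others i)
  others-unique {t} i = Unique.map⁺ (punchIn-injective i _ _) (Unique.allFin⁺ t)

  others-≢ : ∀ {t} (i : Fin (suc t)) → All (_≢ i) (others i)
  others-≢ {t} i = All.map⁺ (All.universal (punchInᵢ≢i i) (allFin t))

  length-others : ∀ {t} (i : Fin (suc t)) → length (others i) ≡ t
  length-others {t} i = trans (length-map (punchIn i) (allFin t)) (length-tabulate _)

  pigeon : ∀ {n} {x y a b c : Fin n} → a ≢ b → a ≢ c → b ≢ c →
    a ≡ x ⊎ a ≡ y → b ≡ x ⊎ b ≡ y → ¬ (c ≡ x ⊎ c ≡ y)
  pigeon ab ac bc (inj₁ refl) (inj₁ refl) _           = ab refl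
  pigeon ab ac bc (inj₂ refl) (inj₂ refl) _           = ab refl
  pigeon ab ac bc (inj₁ refl) (inj₂ refl) (inj₁ refl) = ac refl
  pigeon ab ac bc (inj₁ refl) (inj₂ refl) (inj₂ refl) = bc refl
  pigeon ab ac bc (inj₂ refl) (inj₁ refl) (inj₁ refl) = bc refl
  pigeon ab ac bc (inj₂ refl) (inj₁ refl) (inj₂ refl) = ac refl

  -- In units of `s / 60`, each of the four single vertices misses at most 3 and the clique `r` at
  -- most 2, which makes 14.
  claw-arith : ∀ a b c d r s → 20 * a ≤ s → 20 * b ≤ s → 20 * c ≤ s → 20 * d ≤ s → 30 * r ≤ s →
    60 * (a + (b + (c + (d + r)))) ≤ 14 * s
  claw-arith a b c d r s ha hb hc hd hr = begin
    60 * (a + (b + (c + (d + r))))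
      ≡⟨ lem a b c d r ⟩
    3 * (20 * a) + 3 * (20 * b) + 3 * (20 * c) + 3 * (20 * d) + 2 * (30 * r)
      ≤⟨ +-mono-≤ (+-mono-≤ (+-mono-≤ (+-mono-≤ (*-monoʳ-≤ 3 ha) (*-monoʳ-≤ 3 hb)) (*-monoʳ-≤ 3 hc))
           (*-monoʳ-≤ 3 hd)) (*-monoʳ-≤ 2 hr) ⟩
    3 * s + 3 * s + 3 * s + 3 * s + 2 * s
      ≡⟨ lem′ s ⟩
    14 * s ∎
    where
    open ≤-Reasoning
    lem : ∀ a b c d r → 60 * (a + (b + (c + (d + r)))) ≡
      3 * (20 * a) + 3 * (20 * b) + 3 * (20 * c) + 3 * (20 * d) + 2 * (30 * r)
    lem = solve-∀
    lem′ : ∀ s → 3 * s + 3 * s + 3 * s + 3 * s + 2 * s ≡ 14 * s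
    lem′ = solve-∀

  -- From τ ≤ 2(C + μ) and τ + μ = s we get s ≤ 2C + 3μ, while 60μ ≤ 16s.
  class-arith : ∀ τ μ m s c k → τ + μ ≡ s → τ ≤ 2 * (c + μ) → μ ≤ m → 60 * m ≤ 16 * s → s < 10 * suc (c + k)
  class-arith τ μ m s c k eq hτ hμ hm = ≤-<-trans s≤10c (*-monoʳ-< 10 (s≤s (m≤m+n c k)))
    where
    open ≤-Reasoning
    lem₁ : ∀ c μ → 20 * (2 * (c + μ) + μ) ≡ 40 * c + 60 * μ
    lem₁ = solve-∀
    lem₂ : ∀ c → 40 * c ≡ 4 * (10 * c)
    lem₂ = solve-∀
    lem₃ : ∀ s → 20 * s ≡ 4 * s + 16 * s
    lem₃ = solve-∀
    s≤10c : s ≤ 10 * c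
    s≤10c = *-cancelˡ-≤ 4 (+-cancelʳ-≤ (16 * s) (4 * s) (4 * (10 * c)) (begin
      4 * s + 16 * s           ≡⟨ lem₃ s ⟨
      20 * s                   ≡⟨ cong (20 *_) eq ⟨
      20 * (τ + μ)             ≤⟨ *-monoʳ-≤ 20 (+-monoˡ-≤ μ hτ) ⟩
      20 * (2 * (c + μ) + μ)   ≡⟨ lem₁ c μ ⟩
      40 * c + 60 * μ          ≤⟨ +-monoʳ-≤ (40 * c) (≤-trans (*-monoʳ-≤ 60 hμ) hm) ⟩
      40 * c + 16 * s          ≡⟨ cong (_+ 16 * s) (lem₂ c) ⟩
      4 * (10 * c) + 16 * s    ∎))

  -- With e = n ∸ t s the hypothesis 100 n ≤ 100 t s + n reads n ≤ t s + e and 100 e ≤ n.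
  balance-gap : ∀ n ts → 100 * n ≤ 100 * ts + n → 100 * (n ∸ ts) ≤ n
  balance-gap n ts h = ≤-trans (≤-reflexive (*-distribˡ-∸ 100 n ts)) (m≤n+o⇒m∸n≤o (100 * n) (100 * ts) h)

  -- Degree `D` about (t-1)n/t leaves at most n/t + C vertices for `mi` and `mj` together. A thin
  -- neighbourhood `τ` makes `mj` at least 29/30 of `sj`, up to `K`. So `mi` is at most about a
  -- thirtieth of n/t, and the room between 1/30 and 1/20 absorbs `C`, `K` and the imbalance of the
  -- classes. All inequalities are multiplied through by `t`.
  high-arith : ∀ t′ n D mi mj τ si sj K C → let t = suc t′ in
    t′ * n ≤ t * D + t * C → mi + (mj + D) ≤ n → τ + mj ≡ sj → 30 * τ ≤ 30 * K + sj →
    100 * n ≤ 100 * (t * si) + n → 100 * n ≤ 100 * (t * sj) + n → 200 * (t * (C + K)) ≤ n →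
    20 * mi ≤ si
  high-arith t′ n D mi mj τ si sj K C high disj split thin bi bj big = *-cancelˡ-≤ t (*-cancelˡ-≤ 3 final)
    where
    open ≤-Reasoning
    t = suc t′
    -- Shortfall of a class against the average n/t, scaled by `t`. Truncated subtraction makes it 0
    -- for a class above average, and `n≤i` holds in either case.
    ei = n ∸ t * si
    ej = n ∸ t * sj
    n≤i : n ≤ t * si + ei
    n≤i = m≤n+m∸n n (t * si)
    n≤j : n ≤ t * sj + ej
    n≤j = m≤n+m∸n n (t * sj)
    both-missed : t * mi + t * mj ≤ n + t * C
    both-missed = +-cancelʳ-≤ (t′ * n) _ _ (begin
      t * mi + t * mj + t′ * n            ≤⟨ +-monoʳ-≤ (t * mi + t * mj) high ⟩
      t * mi + t * mj + (t * D + t * C)   ≡⟨ l₁ t mi mj D C ⟩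
      t * (mi + (mj + D)) + t * C         ≤⟨ +-monoˡ-≤ (t * C) (*-monoʳ-≤ t disj) ⟩
      t * n + t * C                       ≡⟨ l₂ t′ n (t * C) ⟩
      n + t * C + t′ * n                  ∎)
      where
      l₁ : ∀ t a b d c → t * a + t * b + (t * d + t * c) ≡ t * (a + (b + d)) + t * c
      l₁ = solve-∀
      l₂ : ∀ t′ n c → suc t′ * n + c ≡ n + c + t′ * n
      l₂ = solve-∀
    mostly-missed : 29 * sj ≤ 30 * mj + 30 * K
    mostly-missed = +-cancelʳ-≤ sj _ _ (begin
      29 * sj + sj               ≡⟨ +-comm (29 * sj) sj ⟩
      30 * sj                    ≡⟨ cong (30 *_) split ⟨
      30 * (τ + mj)              ≡⟨ *-distribˡ-+ 30 τ mj ⟩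
      30 * τ + 30 * mj           ≤⟨ +-monoˡ-≤ (30 * mj) thin ⟩
      30 * K + sj + 30 * mj      ≡⟨ l (30 * K) sj (30 * mj) ⟩
      30 * mj + 30 * K + sj      ∎)
      where
      l : ∀ a b c → a + b + c ≡ c + a + b
      l = solve-∀
    mi-small : 30 * (t * mi) ≤ n + 29 * ej + 30 * (t * (C + K))
    mi-small = +-cancelʳ-≤ (29 * (t * sj)) _ _ (begin
      30 * (t * mi) + 29 * (t * sj)                   ≡⟨ l₁ t mi sj ⟩
      30 * (t * mi) + t * (29 * sj)                   ≤⟨ +-monoʳ-≤ (30 * (t * mi)) (*-monoʳ-≤ t mostly-missed) ⟩
      30 * (t * mi) + t * (30 * mj + 30 * K)          ≡⟨ l₂ t mi mj K ⟩
      30 * (t * mi + t * mj) + 30 * (t * K)           ≤⟨ +-monoˡ-≤ (30 * (t * K)) (*-monoʳ-≤ 30 both-missed) ⟩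
      30 * (n + t * C) + 30 * (t * K)                 ≡⟨ l₃ n t C K ⟩
      n + 30 * (t * (C + K)) + 29 * n                 ≤⟨ +-monoʳ-≤ (n + 30 * (t * (C + K))) (*-monoʳ-≤ 29 n≤j) ⟩
      n + 30 * (t * (C + K)) + 29 * (t * sj + ej)     ≡⟨ l₄ n (30 * (t * (C + K))) (t * sj) ej ⟩
      n + 29 * ej + 30 * (t * (C + K)) + 29 * (t * sj) ∎)
      where
      l₁ : ∀ t m s → 30 * (t * m) + 29 * (t * s) ≡ 30 * (t * m) + t * (29 * s)
      l₁ = solve-∀
      l₂ : ∀ t a b k → 30 * (t * a) + t * (30 * b + 30 * k) ≡ 30 * (t * a + t * b) + 30 * (t * k)
      l₂ = solve-∀
      l₃ : ∀ n t c k → 30 * (n + t * c) + 30 * (t * k) ≡ n + 30 * (t * (c + k)) + 29 * n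
      l₃ = solve-∀
      l₄ : ∀ n h s e → n + h + 29 * (s + e) ≡ n + 29 * e + h + 29 * s
      l₄ = solve-∀
    -- These are the error terms left when `mi-small` is doubled and `3 * ei` is added. In
    -- hundredths of `n` they cost 58, 3 and 30, in total 91.
    gaps : 58 * ej + 3 * ei + 60 * (t * (C + K)) ≤ n
    gaps = *-cancelˡ-≤ 100 (begin
      100 * (58 * ej + 3 * ei + 60 * h)                ≡⟨ l ej ei h ⟩
      58 * (100 * ej) + 3 * (100 * ei) + 30 * (200 * h)
        ≤⟨ +-mono-≤ (+-mono-≤ (*-monoʳ-≤ 58 (balance-gap n (t * sj) bj))
           (*-monoʳ-≤ 3 (balance-gap n (t * si) bi))) (*-monoʳ-≤ 30 big) ⟩
      58 * n + 3 * n + 30 * n                          ≡⟨ l′ n ⟩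
      91 * n                                           ≤⟨ *-monoˡ-≤ n (m≤m+n 91 9) ⟩
      100 * n                                          ∎)
      where
      h = t * (C + K)
      l : ∀ a b h → 100 * (58 * a + 3 * b + 60 * h) ≡ 58 * (100 * a) + 3 * (100 * b) + 30 * (200 * h)
      l = solve-∀
      l′ : ∀ n → 58 * n + 3 * n + 30 * n ≡ 91 * n
      l′ = solve-∀
    final : 3 * (t * (20 * mi)) ≤ 3 * (t * si)
    final = +-cancelʳ-≤ (3 * ei) _ _ (begin
      3 * (t * (20 * mi)) + 3 * ei          ≡⟨ l₁ t mi ei ⟩
      2 * (30 * (t * mi)) + 3 * ei          ≤⟨ +-monoˡ-≤ (3 * ei) (*-monoʳ-≤ 2 mi-small) ⟩
      2 * (n + 29 * ej + 30 * (t * (C + K))) + 3 * ei ≡⟨ l₂ n ej ei (t * (C + K)) ⟩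
      2 * n + (58 * ej + 3 * ei + 60 * (t * (C + K))) ≤⟨ +-monoʳ-≤ (2 * n) gaps ⟩
      2 * n + n                             ≡⟨ +-comm (2 * n) n ⟩
      3 * n                                 ≤⟨ *-monoʳ-≤ 3 n≤i ⟩
      3 * (t * si + ei)                     ≡⟨ *-distribˡ-+ 3 (t * si) ei ⟩
      3 * (t * si) + 3 * ei                 ∎)
      where
      l₁ : ∀ t m e → 3 * (t * (20 * m)) + 3 * e ≡ 2 * (30 * (t * m)) + 3 * e
      l₁ = solve-∀
      l₂ : ∀ n a b h → 2 * (n + 29 * a + 30 * h) + 3 * b ≡ 2 * n + (58 * a + 3 * b + 60 * h)
      l₂ = solve-∀

  -- Edges in links, thin neighbourhoods and near vertices in a leveled graph with dense pairs of
  -- classes.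

  module Structure {n t′ : ℕ} (G : Graph n) (lev : Leveled (2 * suc t′ ∸ 1) G)
    (part : Fin n → Maybe (Fin (suc t′))) (C : ℕ) (∣X∣≤C : countB (inX part) ≤ C)
    (dense : ∀ v i j → part v ≡ just i → i ≢ j →
      60 * suc t′ * nonNbrs G (inS part j) v ≤ countB (inS part j))
    (K : ℕ) (K-bound : 2 * suc C ^ (2 * suc t′) ≤ K)
    (large : ∀ j → 10 * suc (C + K) ≤ countB (inS part j))
    where

    open LeveledGraph G lev

    t : ℕ
    t = suc t′

    S : Fin t → Fin n → Bool
    S = inS part

    s : Fin t → ℕ
    s j = countB (S j)

    miss : Fin t → Fin n → ℕ
    miss j = nonNbrs G (S j)

    -- Each vertex misses at most the fraction 1/(60t) of `S j`, and `2 * t` is the size of a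
    -- largest clique, so a whole clique outside `S j` misses at most a thirtieth.
    miss-elsewhere : ∀ j {ρ} → All (λ v → elsewhere part j v ≡ true) ρ → length ρ ≤ 2 * t →
      30 * sum (map (miss j) ρ) ≤ s j
    miss-elsewhere j {ρ} out len = *-cancelˡ-≤ (2 * t) (begin
      2 * t * (30 * Σm)  ≡⟨ lem t Σm ⟩
      60 * t * Σm        ≤⟨ sum-bound {c = 60 * t} (miss j) (All.map bound out) ⟩
      length ρ * s j     ≤⟨ *-monoˡ-≤ (s j) len ⟩
      2 * t * s j        ∎)
      where
      open ≤-Reasoning
      Σm = sum (map (miss j) ρ)
      lem : ∀ t m → 2 * t * (30 * m) ≡ 60 * t * m
      lem = solve-∀
      bound : ∀ {v} → elsewhere part j v ≡ true → 60 * t * miss j v ≤ s j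
      bound {v} h = let i , eq , ne = elsewhere⁻ part j v h in dense v i j eq ne

    independent≤K : ∀ {σ} (A : Fin n → Bool) → Clique G σ →
      (∀ v → A v ≡ true → lk G σ v ≡ true) →
      (∀ u v → A u ≡ true → A v ≡ true → ¬ adj G u v ≡ true) →
      (∀ v → lk G σ v ≡ true → A v ≡ true ⊎ inX part v ≡ true) →
      countB A ≤ K
    independent≤K {σ} A cl A⊆ ind cov with search G A
    ... | inj₂ none = subst (_≤ K) (sym (count-none (λ v → ¬-not (none v)))) z≤n
    -- A vertex of `A` extends `σ`, so `σ` has at most `2 * t ∸ 1` vertices and the truncated
    -- difference in the exponent is exact.
    ... | inj₁ (v , av) = begin
      countB A
        ≤⟨ independent≤ (2 * t ∸ 1 ∸ length σ) A (inX part) cl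
             (m+[n∸m]≡n (ℕ.s≤s⁻¹ (length≤ (clique-∷ G cl (A⊆ v av))))) A⊆ ind cov ⟩
      2 * countB (inX part) ^ (2 * t ∸ 1 ∸ length σ)
        ≤⟨ *-monoʳ-≤ 2 (^-monoˡ-≤ (2 * t ∸ 1 ∸ length σ) (m≤n⇒m≤1+n ∣X∣≤C)) ⟩
      -- The base `suc C` is positive even for `C = 0`, so its powers do not decrease as the
      -- exponent grows.
      2 * suc C ^ (2 * t ∸ 1 ∸ length σ)
        ≤⟨ *-monoʳ-≤ 2 (^-monoʳ-≤ (suc C) (≤-trans (m∸n≤m (2 * t ∸ 1) (length σ)) (m∸n≤m (2 * t) 1))) ⟩
      2 * suc C ^ (2 * t) ≤⟨ K-bound ⟩
      K ∎
      where open ≤-Reasoning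

    -- After saturation outside `S j`, the link lies in the union of `S j` and `X`. The vertices of
    -- `ρ` and those added belong to one clique and remove at most a thirtieth of `S j`, so more
    -- than `K` vertices of `S j` remain, too many for an independent set. The separate list `β`
    -- allows a starting clique, such as a vertex of `X`, whose non-neighbours are not controlled by
    -- `dense`.
    edge-in-link : ∀ j β ρ → Clique G (ρ ++ β) → All (λ v → elsewhere part j v ≡ true) ρ →
      30 * K + s j < 30 * countB (λ v → S j v ∧ lk G β v) →
      HasEdge G (λ v → S j v ∧ lk G (ρ ++ β) v)
    edge-in-link j β ρ cl out big with saturate (elsewhere part j) cl
    ... | ρ′ , cl′ , out′ , max with hasEdge? G (λ v → S j v ∧ lk G (ρ′ ++ (ρ ++ β)) v)
    ... | inj₁ e = hasEdge-mono G (λ v p → ∧-true (∧-conicalˡ _ _ p)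
            (lk⁺ G {ρ ++ β} (All.++⁻ʳ ρ′ (lk⁻ G {ρ′ ++ (ρ ++ β)} (∧-conicalʳ (S j v) _ p))))) e
    ... | inj₂ ind = contradiction (*-cancelˡ-< 30 K τ (+-cancelʳ-< (s j) (30 * K) (30 * τ) chain)) (≤⇒≯ τ≤K)
      where
      T : Fin n → Bool
      T v = S j v ∧ lk G (ρ′ ++ (ρ ++ β)) v
      τ = countB T
      cov : ∀ v → lk G (ρ′ ++ (ρ ++ β)) v ≡ true → T v ≡ true ⊎ inX part v ≡ true
      cov v h with ¬elsewhere part j v (max v h)
      ... | inj₁ p = inj₁ (∧-true p h)
      ... | inj₂ q = inj₂ q
      τ≤K : τ ≤ K
      τ≤K = independent≤K T cl′ (λ v → ∧-conicalʳ (S j v) _) ind cov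
      len : length (ρ′ ++ ρ) ≤ 2 * t
      len = ≤-trans (≤-trans (m≤m+n _ (length β)) (≤-reflexive
              (trans (sym (length-++ (ρ′ ++ ρ))) (cong length (++-assoc ρ′ ρ β))))) (length≤ cl′)
      open ≤-Reasoning
      chain : 30 * K + s j < 30 * τ + s j
      chain = begin-strict
        30 * K + s j <⟨ big ⟩
        30 * countB (λ v → S j v ∧ lk G β v)
          ≤⟨ *-monoʳ-≤ 30 (subst (λ σ → countB (λ v → S j v ∧ lk G β v) ≤
                 countB (λ v → S j v ∧ lk G σ v) + sum (map (miss j) (ρ′ ++ ρ)))
               (++-assoc ρ′ ρ β) (count-lk-++ G (S j) (ρ′ ++ ρ) β)) ⟩
        30 * (τ + sum (map (miss j) (ρ′ ++ ρ)))
          ≡⟨ *-distribˡ-+ 30 τ _ ⟩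
        30 * τ + 30 * sum (map (miss j) (ρ′ ++ ρ))
          ≤⟨ +-monoʳ-≤ (30 * τ) (miss-elsewhere j (All.++⁺ out′ out) len) ⟩
        30 * τ + s j ∎

    edge-in-class : ∀ j ρ → Clique G ρ → All (λ v → elsewhere part j v ≡ true) ρ →
      HasEdge G (λ v → S j v ∧ lk G ρ v)
    edge-in-class j ρ cl out =
      subst (λ σ → HasEdge G (λ v → S j v ∧ lk G σ v)) (++-identityʳ ρ)
        (edge-in-link j [] ρ (subst (Clique G) (sym (++-identityʳ ρ)) cl) out (begin-strict
          30 * K + s j        <⟨ +-monoˡ-< (s j) K-small ⟩
          29 * s j + s j      ≡⟨ +-comm (29 * s j) (s j) ⟩
          30 * s j            ≤⟨ *-monoʳ-≤ 30 (count-mono {f = S j} (λ v p → ∧-true p refl)) ⟩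
          30 * countB (λ v → S j v ∧ true) ∎))
      where
      open ≤-Reasoning
      K-small : 30 * K < 29 * s j
      -- Here 58 is 29 times 2, so `2 * suc (C + K) ≤ s j` finishes the chain.
      K-small = ≤-<-trans (*-monoˡ-≤ K (m≤m+n 30 28)) (<-≤-trans (*-monoʳ-< 58 (s≤s (m≤n+m K C)))
        (≤-trans (≤-reflexive (*-assoc 29 2 (suc (C + K))))
          (*-monoʳ-≤ 29 (≤-trans (*-monoˡ-≤ (suc (C + K)) (m≤m+n 2 8)) (large j)))))

    -- Two vertices from every class but `i`, which is one vertex short of the size `d` at which
    -- links are pairs.
    transversal : ∀ i → ∃ λ ρ → Clique G ρ × length ρ ≡ 2 * t′ × All (λ v → elsewhere part i v ≡ true) ρ
    transversal i =
      let ρ , cl , len , h = greedy G S (others i) (others-unique i) (All.universal edge (others i)) in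
      ρ , cl , trans len (cong (2 *_) (length-others i)) ,
      All.map (λ (k , k∈ , p) → inS-elsewhere part p (All.lookup (others-≢ i) k∈)) h
      where
      edge : ∀ j ρ → Clique G ρ → All (λ v → ∃ λ k → k ≢ j × S k v ≡ true) ρ →
             HasEdge G (λ v → S j v ∧ lk G ρ v)
      edge j ρ cl h = edge-in-class j ρ cl (All.map (λ (k , ne , p) → inS-elsewhere part p ne) h)

    -- Suppose `T`, the part of `S j` in the link of `A ++ σ`, is independent. The link of `σ` lies
    -- in the union of `S j` and `X`, so it is covered by `T` and `Y`. As `σ` has `d − 1` vertices,
    -- `independent≤` applies with exponent 1 and is linear in `Y`; this matters because `Y` may
    -- contain a positive fraction `μ` of `S j`. Only `σ` has to be a clique, so `A` may hold
    -- non-adjacent vertices.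
    dense-edge-via : ∀ j A → 60 * sum (map (miss j) A) ≤ 14 * s j →
      ∀ σ → Clique G σ → length σ ≡ 2 * t′ → All (λ v → elsewhere part j v ≡ true) σ →
      HasEdge G (λ v → S j v ∧ lk G A v)
    dense-edge-via j A sparse σ cl len out with hasEdge? G (λ v → S j v ∧ lk G (A ++ σ) v)
    ... | inj₁ e = hasEdge-mono G (λ v p → ∧-true (∧-conicalˡ _ _ p)
            (lk⁺ G {A} (All.++⁻ˡ A (lk⁻ G {A ++ σ} (∧-conicalʳ (S j v) _ p))))) e
    ... | inj₂ ind = contradiction (large j) (<⇒≱ small)
      where
      T Y : Fin n → Bool
      T v = S j v ∧ lk G (A ++ σ) v
      Y v = inX part v ∨ (S j v ∧ not (lk G (A ++ σ) v))
      τ = countB T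
      μ = countB (λ v → S j v ∧ not (lk G (A ++ σ) v))
      Σm = sum (map (miss j) (A ++ σ))
      ∨-split : ∀ {a b} → a ∨ b ≡ true → a ≡ true ⊎ b ≡ true
      ∨-split {true}  h = inj₁ refl
      ∨-split {false} h = inj₂ h
      ∨-inl : ∀ {a b} → a ≡ true → a ∨ b ≡ true
      ∨-inl refl = refl
      ∨-inr : ∀ {a b} → b ≡ true → a ∨ b ≡ true
      ∨-inr {a} refl = ∨-zeroʳ a
      len-suc : length σ + 1 ≡ 2 * t ∸ 1
      len-suc = trans (cong (_+ 1) len) (trans (+-comm _ 1) (sym (+-suc t′ (t′ + 0))))
      cov : ∀ v → lk G σ v ≡ true → T v ≡ true ⊎ Y v ≡ true
      cov v h with elsewhere part j v Bool.≟ true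
      -- A vertex `v` of another class in the link of `σ`, together with `σ` and an edge of `S j`
      -- joined to both, would form a clique on `2 * t + 1` vertices.
      ... | yes p = let e = edge-in-class j (v ∷ σ) (clique-∷ G cl h) (p ∷ out) in
        contradiction (length≤ (clique-edge G (clique-∷ G cl h) e (λ u → ∧-conicalʳ (S j u) _)))
          (<⇒≱ (≤-reflexive (cong (2 +_) (trans (sym len-suc) (+-comm _ 1)))))
      ... | no ¬p with ¬elsewhere part j v ¬p
      ... | inj₂ x = inj₂ (∨-inl x)
      ... | inj₁ q with lk G (A ++ σ) v Bool.≟ true
      ... | yes r = inj₁ (∧-true q r)
      ... | no ¬r = inj₂ (∨-inr (∧-true q (cong not (¬-not ¬r))))
      Y-bound : countB Y ≤ C + μ
      Y-bound = ≤-trans (count-split {f = Y} (λ v → ∨-split)) (+-monoˡ-≤ μ ∣X∣≤C)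
      τ-bound : τ ≤ 2 * (C + μ)
      τ-bound = ≤-trans (independent≤ 1 T Y cl len-suc
          (λ v p → lk⁺ G {σ} (All.++⁻ʳ A (lk⁻ G {A ++ σ} (∧-conicalʳ (S j v) _ p)))) ind cov)
        (*-monoʳ-≤ 2 (≤-trans (≤-reflexive (*-identityʳ _)) Y-bound))
      s≡ : τ + μ ≡ s j
      s≡ = count-∧-not (S j) (lk G (A ++ σ))
      μ≤ : μ ≤ Σm
      μ≤ = +-cancelˡ-≤ τ μ Σm (subst (_≤ τ + Σm) (sym s≡) (count-lk G (S j) (A ++ σ)))
      Σm-bound : 60 * Σm ≤ 16 * s j
      Σm-bound = begin
        60 * sum (map (miss j) (A ++ σ))
          ≡⟨ cong (λ z → 60 * z) (trans (cong sum (map-++ (miss j) A σ)) (sum-++ (map (miss j) A) _)) ⟩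
        60 * (sum (map (miss j) A) + sum (map (miss j) σ)) ≡⟨ split (sum (map (miss j) A)) (sum (map (miss j) σ)) ⟩
        60 * sum (map (miss j) A) + 2 * (30 * sum (map (miss j) σ))
          ≤⟨ +-mono-≤ sparse (*-monoʳ-≤ 2 (miss-elsewhere j out
               (≤-trans (≤-reflexive len) (*-monoʳ-≤ 2 (n≤1+n t′))))) ⟩
        14 * s j + 2 * s j ≡⟨ *-distribʳ-+ (s j) 14 2 ⟨
        16 * s j ∎
        where
        open ≤-Reasoning
        split : ∀ a b → 60 * (a + b) ≡ 60 * a + 2 * (30 * b)
        split = solve-∀
      small : s j < 10 * suc (C + K)
      small = class-arith τ μ Σm (s j) C K s≡ τ-bound μ≤ Σm-bound

    dense-edge : ∀ j A → 60 * sum (map (miss j) A) ≤ 14 * s j → HasEdge G (λ v → S j v ∧ lk G A v)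
    dense-edge j A sparse =
      let σ , cl , len , out = transversal j in dense-edge-via j A sparse σ cl len out

    -- With the constant 20, four near vertices and two cliques outside S j together miss less than
    -- a third of S j, which is what dense-edge needs.
    Near : Fin t → Fin n → Set
    Near i v = ∀ j → j ≢ i → 20 * miss j v ≤ s j

    no-claw : ∀ i {v a b c} → Near i v → Near i a → Near i b → Near i c →
      a ≢ b → a ≢ c → b ≢ c → adj G v a ≡ true → adj G v b ≡ true → ¬ adj G v c ≡ true
    no-claw i {v} {a} {b} {c} nv na nb nc a≢b a≢c b≢c va vb vc =
      let ρ , cl , len , h = greedy G D (others i) (others-unique i) (All.map edge (others-≢ i)) in
      close ρ cl (trans len (cong (2 *_) (length-others i))) h
      where
      -- Restricting the classes to common neighbours of the four vertices puts the whole greedy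
      -- clique into their link. Then `v ∷ ρ` has `2 * t ∸ 1` vertices and its link would contain
      -- all of `a`, `b`, `c`.
      D : Fin t → Fin n → Bool
      D j u = S j u ∧ lk G (a ∷ b ∷ c ∷ v ∷ []) u
      edge : ∀ {j} → j ≢ i → ∀ ρ → Clique G ρ → All (λ u → ∃ λ k → k ≢ j × D k u ≡ true) ρ →
             HasEdge G (λ u → D j u ∧ lk G ρ u)
      edge {j} j≢i ρ cl h = hasEdge-mono G shuffle (dense-edge j (a ∷ b ∷ c ∷ v ∷ ρ)
          (claw-arith (miss j a) (miss j b) (miss j c) (miss j v) (sum (map (miss j) ρ)) (s j)
            (na j j≢i) (nb j j≢i) (nc j j≢i) (nv j j≢i)
            (miss-elsewhere j (All.map (λ (k , ne , p) → inS-elsewhere part (∧-conicalˡ _ _ p) ne) h) (length≤ cl))))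
        where
        shuffle : ∀ u → S j u ∧ lk G (a ∷ b ∷ c ∷ v ∷ ρ) u ≡ true → D j u ∧ lk G ρ u ≡ true
        shuffle u p = let q = ∧-conicalʳ (S j u) _ p ; r = lk⁻ G {a ∷ b ∷ c ∷ v ∷ ρ} q in
          ∧-true (∧-true (∧-conicalˡ (S j u) _ p) (lk⁺ G {a ∷ b ∷ c ∷ v ∷ []} (All.++⁻ˡ (a ∷ b ∷ c ∷ v ∷ []) r)))
            (lk⁺ G {ρ} (All.++⁻ʳ (a ∷ b ∷ c ∷ v ∷ []) r))
      close : ∀ ρ → Clique G ρ → length ρ ≡ 2 * t′ →
        All (λ u → ∃ λ k → k L.∈ others i × D k u ≡ true) ρ → ⊥
      close ρ cl len h = pigeon a≢b a≢c b≢c (pair a (inLink va λ { (p ∷ _) → p }))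
          (pair b (inLink vb λ { (_ ∷ p ∷ _) → p })) (pair c (inLink vc λ { (_ ∷ _ ∷ p ∷ _) → p }))
        where
        nbr : All (λ u → All (λ w → adj G w u ≡ true) (a ∷ b ∷ c ∷ v ∷ [])) ρ
        nbr = All.map (λ {u} (k , _ , p) → lk⁻ G {a ∷ b ∷ c ∷ v ∷ []} (∧-conicalʳ (S k u) _ p)) h
        len′ : length (v ∷ ρ) ≡ 2 * t ∸ 1
        len′ = trans (cong suc len) (sym (+-suc t′ (t′ + 0)))
        cl′ : Clique G (v ∷ ρ)
        cl′ = All.map (λ { (_ ∷ _ ∷ _ ∷ p ∷ []) → p }) nbr ∷ cl
        pair = proj₂ (proj₂ (link-pair cl′ len′))
        inLink : ∀ {w} → adj G v w ≡ true →
          (∀ {u} → All (λ w → adj G w u ≡ true) (a ∷ b ∷ c ∷ v ∷ []) → adj G w u ≡ true) →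
          lk G (v ∷ ρ) w ≡ true
        inLink vw sel = lk⁺ G {v ∷ ρ} (vw ∷ All.map (λ {u} q → trans (adj-sym G u _) (sel q)) nbr)

    -- Otherwise `edge-in-link` with `β` equal to `x ∷ []` supplies an edge in the neighbourhood of
    -- `x` in every class, and the greedy clique together with `x` has `2 * t + 1` vertices.
    thin-class : ∀ x → ∃ λ j → 30 * countB (λ v → S j v ∧ adj G x v) ≤ 30 * K + s j
    thin-class x with any? (λ j → 30 * countB (λ v → S j v ∧ adj G x v) ≤? 30 * K + s j)
    ... | yes p = p
    ... | no ¬p =
      let ρ , cl , len , h = greedy G D (allFin t) (Unique.allFin⁺ t) (All.universal edge (allFin t)) in
      contradiction (length≤ (All.map (λ {u} (k , _ , p) → ∧-conicalʳ (S k u) _ p) h ∷ cl))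
        (<⇒≱ (≤-reflexive (cong suc (trans (cong (2 *_) (sym (length-tabulate {n = t} (λ i → i)))) (sym len)))))
      where
      D : Fin t → Fin n → Bool
      D j v = S j v ∧ adj G x v
      edge : ∀ j ρ → Clique G ρ → All (λ u → ∃ λ k → k ≢ j × D k u ≡ true) ρ →
             HasEdge G (λ u → D j u ∧ lk G ρ u)
      edge j ρ cl h = hasEdge-mono G shuffle (edge-in-link j (x ∷ []) ρ
          (AllPairs.++⁺ cl ([] ∷ []) (All.map (λ {u} (k , _ , p) →
            trans (adj-sym G u x) (∧-conicalʳ (S k u) _ p) ∷ []) h))
          (All.map (λ (k , ne , p) → inS-elsewhere part (∧-conicalˡ _ _ p) ne) h)
          (<-≤-trans (≰⇒> (λ le → ¬p (j , le))) (*-monoʳ-≤ 30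
            (count-mono {f = D j} (λ v p → ∧-true (∧-conicalˡ (S j v) _ p) (∧-true (∧-conicalʳ (S j v) _ p) refl))))))
        where
        shuffle : ∀ u → S j u ∧ lk G (ρ ++ x ∷ []) u ≡ true → D j u ∧ lk G ρ u ≡ true
        shuffle u p with lk⁻ G {ρ ++ x ∷ []} (∧-conicalʳ (S j u) _ p)
        ... | r with All.++⁻ʳ ρ r
        ... | xu ∷ [] = ∧-true (∧-true (∧-conicalˡ (S j u) _ p) xu) (lk⁺ G {ρ} (All.++⁻ˡ ρ r))

    near-own : ∀ {v i} → part v ≡ just i → Near i v
    near-own {v} {i} eq j j≢i = ≤-trans (*-monoˡ-≤ (miss j v) (≤-trans (m≤m+n 20 40) (m≤m*n 60 t)))
      (dense v i j eq (j≢i ∘ sym))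

    -- The non-neighbours in `S i`, the non-neighbours in `S j` and the neighbours of `x` are
    -- pairwise disjoint sets.
    disjoint-count : ∀ x {i j} → i ≢ j → miss i x + (miss j x + countB (adj G x)) ≤ n
    disjoint-count x {i} {j} i≢j = begin
      miss i x + (miss j x + countB (adj G x))
        ≡⟨ cong₂ _+_ (count≡sum f) (cong₂ _+_ (count≡sum g) (count≡sum (adj G x))) ⟩
      sumF (ind ∘ f) + (sumF (ind ∘ g) + sumF (ind ∘ adj G x))
        ≡⟨ cong (sumF (ind ∘ f) +_) (sumF-+ (ind ∘ g) (ind ∘ adj G x)) ⟨
      sumF (ind ∘ f) + sumF (λ v → ind (g v) + ind (adj G x v))
        ≡⟨ sumF-+ (ind ∘ f) (λ v → ind (g v) + ind (adj G x v)) ⟨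
      sumF (λ v → ind (f v) + (ind (g v) + ind (adj G x v)))
        ≤⟨ sumF-mono (λ v → exclusive (S i v) (S j v) (adj G x v)
             λ p q → i≢j (just-injective (trans (sym (inS⁻ part i v p)) (inS⁻ part j v q)))) ⟩
      sumF {n} (λ _ → 1)
        ≡⟨ sumF-const n 1 ⟩
      n * 1
        ≡⟨ *-identityʳ n ⟩
      n ∎
      where
      open ≤-Reasoning
      f g : Fin n → Bool
      f v = S i v ∧ not (adj G x v)
      g v = S j v ∧ not (adj G x v)
      exclusive : ∀ a b c → (a ≡ true → b ≡ true → ⊥) → ind (a ∧ not c) + (ind (b ∧ not c) + ind c) ≤ 1
      exclusive false false false h = z≤n
      exclusive false false true  h = s≤s z≤n
      exclusive false true  false h = s≤s z≤n
      exclusive false true  true  h = s≤s z≤n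
      exclusive true  false false h = s≤s z≤n
      exclusive true  false true  h = s≤s z≤n
      exclusive true  true  false h = ⊥-elim (h refl refl)
      exclusive true  true  true  h = s≤s z≤n

    -- The class in which `x` has a thin neighbourhood becomes its own: its non-neighbours there
    -- already use up nearly all that the degree permits.
    near-high : (∀ j → 100 * n ≤ 100 * (t * s j) + n) → 200 * (t * (C + K)) ≤ n →
      ∀ x → t′ * n ≤ t * countB (adj G x) + t * C → ∃ λ i → Near i x
    near-high balanced n-large x high =
      let j , thin = thin-class x in
      j , λ i i≢j → high-arith t′ n (countB (adj G x)) (miss i x) (miss j x)
            (countB (λ v → S j v ∧ adj G x v)) (s i) (s j) K C
            high (disjoint-count x i≢j) (count-∧-not (S j) (adj G x)) thin (balanced i) (balanced j) n-large

  -- Degree sums and the edge bound for a partition with sparse classes.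

  <ᵇ-total : ∀ a b → a ≢ b → ind (a <ᵇ b) + ind (b <ᵇ a) ≡ 1
  <ᵇ-total zero    zero    ne = contradiction refl ne
  <ᵇ-total zero    (suc b) ne = refl
  <ᵇ-total (suc a) zero    ne = refl
  <ᵇ-total (suc a) (suc b) ne = <ᵇ-total a b (ne ∘ cong suc)

  -- `numEdges` counts an edge at its smaller endpoint, and the transposed sum counts it at the
  -- larger one.
  handshake : ∀ {n} (G : Graph n) → 2 * numEdges G ≡ sumF (λ u → countB (adj G u))
  handshake {n} G = begin
    2 * numEdges G
      ≡⟨ cong (numEdges G +_) (+-identityʳ (numEdges G)) ⟩
    numEdges G + numEdges G
      ≡⟨ cong₂ _+_ edges (trans edges (sumF-swap (λ u v → e u v))) ⟩
    sumF (λ u → sumF (e u)) + sumF (λ u → sumF (λ v → e v u))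
      ≡⟨ sumF-+ (λ u → sumF (e u)) (λ u → sumF (λ v → e v u)) ⟨
    sumF (λ u → sumF (e u) + sumF (λ v → e v u))
      ≡⟨ sumF-cong (λ u → trans (sym (sumF-+ (e u) (λ v → e v u)))
           (trans (sumF-cong (both u)) (sym (count≡sum (adj G u))))) ⟩
    sumF (λ u → countB (adj G u)) ∎
    where
    open ≡-Reasoning
    e : Fin n → Fin n → ℕ
    e u v = ind (adj G u v ∧ (toℕ u <ᵇ toℕ v))
    edges : numEdges G ≡ sumF (λ u → sumF (e u))
    edges = sumF-cong (λ u → count≡sum (λ v → adj G u v ∧ (toℕ u <ᵇ toℕ v)))
    both : ∀ u v → e u v + e v u ≡ ind (adj G u v)
    both u v rewrite adj-sym G v u with adj G u v in eq
    ... | false = refl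
    ... | true  = <ᵇ-total (toℕ u) (toℕ v) (clique-irrefl G eq ∘ toℕ-injective)

  sumF-delta : ∀ {t} (i : Fin t) (g : Fin t → ℕ) → sumF (λ k → ind (does (i Fin.≟ k)) * g k) ≡ g i
  sumF-delta {suc t} zero g = trans (cong₂ _+_ (+-identityʳ (g zero)) (sumF-0 t)) (+-identityʳ (g zero))
  sumF-delta (suc i) g = sumF-delta i (g ∘ suc)

  2ab≤a²+b² : ∀ a b → 2 * (a * b) ≤ a * a + b * b
  2ab≤a²+b² a b with ≤-total a b
  ... | inj₁ a≤b with m≤n⇒∃[o]m+o≡n a≤b
  ... | c , refl = ≤-trans (m≤m+n (2 * (a * (a + c))) (c * c)) (≤-reflexive (l a c))
    where
    l : ∀ a c → 2 * (a * (a + c)) + c * c ≡ a * a + (a + c) * (a + c)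
    l = solve-∀
  2ab≤a²+b² a b | inj₂ b≤a with m≤n⇒∃[o]m+o≡n b≤a
  ... | c , refl = ≤-trans (m≤m+n (2 * ((b + c) * b)) (c * c)) (≤-reflexive (l b c))
    where
    l : ∀ b c → 2 * ((b + c) * b) + c * c ≡ (b + c) * (b + c) + b * b
    l = solve-∀

  -- Sum `2 * (t * f i * m) ≤ (t * f i)² + m²` over `i`, where `m` is the sum of `f`; then cancel
  -- `t * m²` and a factor `t`.
  cauchy : ∀ {t} (f : Fin t → ℕ) → sumF f * sumF f ≤ t * sumF (λ i → f i * f i)
  cauchy {zero}   f = z≤n
  cauchy {suc t′} f = *-cancelˡ-≤ t (+-cancelʳ-≤ (t * (m * m)) _ _ (begin
    t * (m * m) + t * (m * m)                       ≡⟨ l₁ t m ⟩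
    2 * t * m * m                                   ≡⟨ sumF-*ˡ (2 * t * m) f ⟨
    sumF (λ i → 2 * t * m * f i)                    ≤⟨ sumF-mono (λ i → ≤-trans (≤-reflexive (l₂ t m (f i))) (2ab≤a²+b² (t * f i) m)) ⟩
    sumF (λ i → t * f i * (t * f i) + m * m)        ≡⟨ sumF-cong (λ i → cong (_+ m * m) (l₃ t (f i))) ⟩
    sumF (λ i → t * t * (f i * f i) + m * m)        ≡⟨ sumF-+ (λ i → t * t * (f i * f i)) (λ _ → m * m) ⟩
    sumF (λ i → t * t * (f i * f i)) + sumF {t} (λ _ → m * m)
      ≡⟨ cong₂ _+_ (sumF-*ˡ (t * t) (λ i → f i * f i)) (sumF-const t (m * m)) ⟩
    t * t * sumF (λ i → f i * f i) + t * (m * m)    ≡⟨ cong (_+ t * (m * m)) (*-assoc t t (sumF (λ i → f i * f i))) ⟩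
    t * (t * sumF (λ i → f i * f i)) + t * (m * m)  ∎))
    where
    open ≤-Reasoning
    t = suc t′
    m = sumF f
    l₁ : ∀ t m → t * (m * m) + t * (m * m) ≡ 2 * t * m * m
    l₁ = solve-∀
    l₂ : ∀ t m x → 2 * t * m * x ≡ 2 * (t * x * m)
    l₂ = solve-∀
    l₃ : ∀ t x → t * x * (t * x) ≡ t * t * (x * x)
    l₃ = solve-∀

  -- The bounds on `E₁` and `Q` give `t * E₁ ≤ t′ * m² + 2 * t * m`. Replacing `m` by `n = m + x`,
  -- the contribution of the `x` remaining vertices exceeds the target by at most `t′ * x²`, and the
  -- deficit `C` in each of their degrees pays for this.
  turán-arith : ∀ t′ n m x C D E₁ L Q → let t = suc t′ in
    m + x ≡ n → x ≤ C → D ≤ E₁ + (L + L) → E₁ + Q ≤ m * (m + 2) → m * m ≤ t * Q →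
    t * L + x * (t * C) ≤ x * (t′ * n) → t * D ≤ t′ * n * n + 2 * t * n
  turán-arith t′ n m x C D E₁ L Q refl x≤C hD hE hQ hL =
    +-cancelʳ-≤ (2 * (x * (t * C))) _ _ (begin
      t * D + 2 * (x * (t * C))                 ≤⟨ +-monoˡ-≤ _ (*-monoʳ-≤ t hD) ⟩
      t * (E₁ + (L + L)) + 2 * (x * (t * C))    ≡⟨ l₁ t E₁ L (x * (t * C)) ⟩
      t * E₁ + 2 * (t * L + x * (t * C))        ≤⟨ +-mono-≤ tE₁ (*-monoʳ-≤ 2 hL) ⟩
      t′ * (m * m) + 2 * t * m + 2 * (x * (t′ * (m + x)))
        ≤⟨ m≤m+n _ (2 * t * x) ⟩
      t′ * (m * m) + 2 * t * m + 2 * (x * (t′ * (m + x))) + 2 * t * x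
        ≡⟨ l₂ t′ m x t ⟩
      t′ * (m + x) * (m + x) + 2 * t * (m + x) + x * (t′ * x)
        ≤⟨ +-monoʳ-≤ (t′ * (m + x) * (m + x) + 2 * t * (m + x)) tail ⟩
      t′ * (m + x) * (m + x) + 2 * t * (m + x) + 2 * (x * (t * C)) ∎)
    where
    open ≤-Reasoning
    t = suc t′
    l₁ : ∀ t e l z → t * (e + (l + l)) + 2 * z ≡ t * e + 2 * (t * l + z)
    l₁ = solve-∀
    l₂ : ∀ t′ m x t → t′ * (m * m) + 2 * t * m + 2 * (x * (t′ * (m + x))) + 2 * t * x ≡
      t′ * (m + x) * (m + x) + 2 * t * (m + x) + x * (t′ * x)
    l₂ = solve-∀
    tail : x * (t′ * x) ≤ 2 * (x * (t * C))
    tail = ≤-trans (*-monoʳ-≤ x (*-mono-≤ (n≤1+n t′) x≤C)) (m≤m+n (x * (t * C)) _)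
    tE₁ : t * E₁ ≤ t′ * (m * m) + 2 * t * m
    tE₁ = +-cancelʳ-≤ (m * m) _ _ (begin
      t * E₁ + m * m                     ≤⟨ +-monoʳ-≤ (t * E₁) hQ ⟩
      t * E₁ + t * Q                     ≡⟨ *-distribˡ-+ t E₁ Q ⟨
      t * (E₁ + Q)                       ≤⟨ *-monoʳ-≤ t hE ⟩
      t * (m * (m + 2))                  ≡⟨ l₃ t′ m ⟩
      t′ * (m * m) + 2 * suc t′ * m + m * m ∎)
      where
      l₃ : ∀ t′ m → suc t′ * (m * (m + 2)) ≡ t′ * (m * m) + 2 * suc t′ * m + m * m
      l₃ = solve-∀

  module _ {n t′} (G : Graph n) (q : Fin n → Maybe (Fin (suc t′))) where

    private
      t = suc t′
      X P : Fin n → Bool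
      X = inX q
      P v = not (X v)
      size : Fin t → ℕ
      size i = countB (inS q i)
      m = countB P
      x = countB X

    inS-just : ∀ {v i} → q v ≡ just i → ∀ k → inS q k v ≡ does (i Fin.≟ k)
    inS-just {v} eq k with q v
    inS-just refl k | just i = refl

    inS-nothing : ∀ {v} → q v ≡ nothing → ∀ k → inS q k v ≡ false
    inS-nothing {v} eq k with q v
    inS-nothing refl k | nothing = refl

    inX-just : ∀ {v i} → q v ≡ just i → inX q v ≡ false
    inX-just {v} eq with q v
    inX-just refl | just i = refl

    inX-nothing : ∀ {v} → q v ≡ nothing → inX q v ≡ true
    inX-nothing {v} eq with q v
    inX-nothing refl | nothing = refl

    weight-just : ∀ {v i} → q v ≡ just i → (g : Fin t → ℕ) → sumF (λ k → ind (inS q k v) * g k) ≡ g i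
    weight-just {i = i} eq g = trans (sumF-cong (λ k → cong (λ b → ind b * g k) (inS-just eq k))) (sumF-delta i g)

    weight-nothing : ∀ {v} → q v ≡ nothing → (g : Fin t → ℕ) → sumF (λ k → ind (inS q k v) * g k) ≡ 0
    weight-nothing eq g = trans (sumF-cong (λ k → cong (λ b → ind b * g k) (inS-nothing eq k))) (sumF-0 t)

    sum-sizes : sumF size ≡ m
    sum-sizes = begin
      sumF size
        ≡⟨ sumF-cong (λ k → count≡sum (inS q k)) ⟩
      sumF (λ k → sumF (λ v → ind (inS q k v)))
        ≡⟨ sumF-swap (λ k v → ind (inS q k v)) ⟩
      sumF (λ v → sumF (λ k → ind (inS q k v)))
        ≡⟨ sumF-cong (λ v → trans (sumF-cong (λ k → sym (*-identityʳ (ind (inS q k v))))) (classes v)) ⟩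
      sumF (λ v → ind (P v))
        ≡⟨ count≡sum P ⟨
      m ∎
      where
      open ≡-Reasoning
      classes : ∀ v → sumF (λ k → ind (inS q k v) * 1) ≡ ind (P v)
      classes v = helper (q v) refl
        where
        helper : ∀ w → q v ≡ w → sumF (λ k → ind (inS q k v) * 1) ≡ ind (P v)
        helper nothing  eq = trans (weight-nothing eq (λ _ → 1)) (cong (ind ∘ not) (sym (inX-nothing eq)))
        helper (just i) eq = trans (weight-just eq (λ _ → 1)) (cong (ind ∘ not) (sym (inX-just eq)))

    private
      -- `Q` is the sum of the squared class sizes, written with one summand per vertex, the size of
      -- its class, so that it can be added to `E₁` vertex by vertex.
      Q E₁ L D : ℕ
      Q  = sumF (λ u → sumF (λ k → ind (inS q k u) * size k))
      E₁ = sumF (λ u → ind (P u) * countB (λ v → adj G u v ∧ P v))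
      L  = sumF (λ u → ind (X u) * countB (adj G u))
      D  = sumF (λ u → countB (adj G u))

    Q≡ : Q ≡ sumF (λ k → size k * size k)
    Q≡ = trans (sumF-swap (λ u k → ind (inS q k u) * size k)) (sumF-cong (λ k →
      trans (sumF-*ʳ (ind ∘ inS q k) (size k)) (cong (_* size k) (sym (count≡sum (inS q k))))))

    -- An ordered adjacent pair lies within the classes or has its first or its second entry in `X`;
    -- by symmetry of `adj` the last two cases both contribute `L`.
    D≤ : D ≤ E₁ + (L + L)
    D≤ = begin
      D
        ≡⟨ sumF-cong (λ u → count≡sum (adj G u)) ⟩
      sumF (λ u → sumF (λ v → ind (adj G u v)))
        ≤⟨ sumF-mono (λ u → sumF-mono (λ v → three (X u) (X v) (adj G u v))) ⟩
      sumF (λ u → sumF (λ v → a u v + (b u v + c u v)))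
        ≡⟨ sumF-cong (λ u → trans (sumF-+ (a u) (λ v → b u v + c u v)) (cong (sumF (a u) +_) (sumF-+ (b u) (c u)))) ⟩
      sumF (λ u → sumF (a u) + (sumF (b u) + sumF (c u)))
        ≡⟨ sumF-+ (sumF ∘ a) (λ u → sumF (b u) + sumF (c u)) ⟩
      sumF (sumF ∘ a) + sumF (λ u → sumF (b u) + sumF (c u))
        ≡⟨ cong (sumF (sumF ∘ a) +_) (sumF-+ (sumF ∘ b) (sumF ∘ c)) ⟩
      sumF (sumF ∘ a) + (sumF (sumF ∘ b) + sumF (sumF ∘ c))
        ≡⟨ cong₂ _+_ a≡ (cong₂ _+_ b≡ (trans c≡b b≡)) ⟩
      E₁ + (L + L) ∎
      where
      open ≤-Reasoning
      a b c : Fin n → Fin n → ℕ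
      a u v = ind (P u) * ind (adj G u v ∧ P v)
      b u v = ind (X u) * ind (adj G u v)
      c u v = ind (X v) * ind (adj G u v)
      three : ∀ x y e → ind e ≤ ind (not x) * ind (e ∧ not y) + (ind x * ind e + ind y * ind e)
      three x     y     false = z≤n
      three false false true  = s≤s z≤n
      three false true  true  = s≤s z≤n
      three true  y     true  = s≤s z≤n
      a≡ : sumF (sumF ∘ a) ≡ E₁
      a≡ = sumF-cong (λ u → trans (sumF-*ˡ (ind (P u)) (λ v → ind (adj G u v ∧ P v)))
        (cong (ind (P u) *_) (sym (count≡sum (λ v → adj G u v ∧ P v)))))
      b≡ : sumF (sumF ∘ b) ≡ L
      b≡ = sumF-cong (λ u → trans (sumF-*ˡ (ind (X u)) (λ v → ind (adj G u v)))
        (cong (ind (X u) *_) (sym (count≡sum (adj G u)))))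
      c≡b : sumF (sumF ∘ c) ≡ sumF (sumF ∘ b)
      c≡b = trans (sumF-swap c) (sumF-cong (λ v → sumF-cong (λ u → cong (λ e → ind (X v) * ind e) (adj-sym G u v))))

    m+x≡n : m + x ≡ n
    m+x≡n = trans (cong₂ _+_ (count≡sum P) (count≡sum X)) (trans (sym (sumF-+ (ind ∘ P) (ind ∘ X)))
      (trans (sumF-cong (λ v → one (X v))) (trans (sumF-const n 1) (*-identityʳ n))))
      where
      one : ∀ b → ind (not b) + ind b ≡ 1
      one false = refl
      one true  = refl

    module _ {C} (∣X∣≤C : x ≤ C)
      (sparse : ∀ u i → q u ≡ just i → countB (λ v → adj G u v ∧ inS q i v) ≤ 2)
      (low : ∀ u → q u ≡ nothing → t * countB (adj G u) + t * C ≤ t′ * n) where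

      -- Inclusion and exclusion inside `P`: the neighbours of `u` and the class of `u` overlap in
      -- at most two vertices.
      degree-in-P : ∀ {u i} → q u ≡ just i → countB (λ v → adj G u v ∧ P v) + size i ≤ m + 2
      degree-in-P {u} {i} eq = begin
        countB (λ v → adj G u v ∧ P v) + size i
          ≡⟨ cong₂ _+_ (count≡sum (λ v → adj G u v ∧ P v)) (count≡sum (inS q i)) ⟩
        sumF (λ v → ind (adj G u v ∧ P v)) + sumF (λ v → ind (inS q i v))
          ≡⟨ sumF-+ (λ v → ind (adj G u v ∧ P v)) (λ v → ind (inS q i v)) ⟨
        sumF (λ v → ind (adj G u v ∧ P v) + ind (inS q i v))
          ≤⟨ sumF-mono (λ v → modular (adj G u v) (P v) (inS q i v) (λ p → cong not (inX-just (inS⁻ q i v p)))) ⟩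
        sumF (λ v → ind (P v) + ind (adj G u v ∧ inS q i v))
          ≡⟨ sumF-+ (ind ∘ P) (λ v → ind (adj G u v ∧ inS q i v)) ⟩
        sumF (ind ∘ P) + sumF (λ v → ind (adj G u v ∧ inS q i v))
          ≡⟨ cong₂ _+_ (count≡sum P) (count≡sum (λ v → adj G u v ∧ inS q i v)) ⟨
        m + countB (λ v → adj G u v ∧ inS q i v)
          ≤⟨ +-monoʳ-≤ m (sparse u i eq) ⟩
        m + 2 ∎
        where
        open ≤-Reasoning
        modular : ∀ e p s → (s ≡ true → p ≡ true) → ind (e ∧ p) + ind s ≤ ind p + ind (e ∧ s)
        modular false p s     h = ≤-trans (ind-mono h) (m≤m+n (ind p) 0)
        modular true  p s     h = ≤-refl

      E₁+Q≤ : E₁ + Q ≤ m * (m + 2)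
      E₁+Q≤ = begin
        E₁ + Q
          ≡⟨ sumF-+ (λ u → ind (P u) * countB (λ v → adj G u v ∧ P v)) (λ u → sumF (λ k → ind (inS q k u) * size k)) ⟨
        sumF (λ u → ind (P u) * countB (λ v → adj G u v ∧ P v) + sumF (λ k → ind (inS q k u) * size k))
          ≤⟨ sumF-mono (λ u → per u (q u) refl) ⟩
        sumF (λ u → ind (P u) * (m + 2))
          ≡⟨ sumF-*ʳ (ind ∘ P) (m + 2) ⟩
        sumF (ind ∘ P) * (m + 2)
          ≡⟨ cong (_* (m + 2)) (count≡sum P) ⟨
        m * (m + 2) ∎
        where
        open ≤-Reasoning
        per : ∀ u w → q u ≡ w → ind (P u) * countB (λ v → adj G u v ∧ P v) + sumF (λ k → ind (inS q k u) * size k)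
          ≤ ind (P u) * (m + 2)
        per u nothing  eq rewrite inX-nothing eq | weight-nothing eq size = z≤n
        per u (just i) eq rewrite inX-just eq | weight-just eq size
          | +-identityʳ (countB (λ v → adj G u v ∧ P v)) | +-identityʳ (m + 2) = degree-in-P eq

      L≤ : t * L + x * (t * C) ≤ x * (t′ * n)
      L≤ = begin
        t * L + x * (t * C)
          ≡⟨ cong₂ _+_ (sym (sumF-*ˡ t (λ u → ind (X u) * countB (adj G u))))
               (trans (cong (_* (t * C)) (count≡sum X)) (sym (sumF-*ʳ (ind ∘ X) (t * C)))) ⟩
        sumF (λ u → t * (ind (X u) * countB (adj G u))) + sumF (λ u → ind (X u) * (t * C))
          ≡⟨ sumF-+ (λ u → t * (ind (X u) * countB (adj G u))) (λ u → ind (X u) * (t * C)) ⟨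
        sumF (λ u → t * (ind (X u) * countB (adj G u)) + ind (X u) * (t * C))
          ≤⟨ sumF-mono (λ u → per u (q u) refl) ⟩
        sumF (λ u → ind (X u) * (t′ * n))
          ≡⟨ trans (sumF-*ʳ (ind ∘ X) (t′ * n)) (cong (_* (t′ * n)) (sym (count≡sum X))) ⟩
        x * (t′ * n) ∎
        where
        open ≤-Reasoning
        per : ∀ u w → q u ≡ w → t * (ind (X u) * countB (adj G u)) + ind (X u) * (t * C) ≤ ind (X u) * (t′ * n)
        per u (just i) eq rewrite inX-just eq = ≤-reflexive (trans (+-identityʳ (t * 0)) (*-zeroʳ t))
        per u nothing  eq rewrite inX-nothing eq
          | +-identityʳ (countB (adj G u)) | +-identityʳ (t * C) | +-identityʳ (t′ * n) = low u eq

      edge-bound : 2 * t * numEdges G ≤ t′ * n * n + 2 * t * n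
      edge-bound = ≤-trans (≤-reflexive (trans (trans (cong (_* numEdges G) (*-comm 2 t)) (*-assoc t 2 (numEdges G)))
          (cong (t *_) (handshake G))))
        (turán-arith t′ n m x C D E₁ L Q m+x≡n ∣X∣≤C D≤ E₁+Q≤
          (subst₂ _≤_ (cong₂ _*_ sum-sizes sum-sizes) (cong (t *_) (sym Q≡)) (cauchy size)) L≤)

  -- Moving vertices of high degree into classes, and the resulting edge bound.

  split-arith : ∀ k s d m → d + m ≡ s → k * s ≤ k * d + s → k * m ≤ s
  split-arith k s d m eq h = +-cancelˡ-≤ (k * d) (k * m) s
    (≤-trans (≤-reflexive (trans (sym (*-distribˡ-+ k d m)) (cong (k *_) eq))) h)

  -- A balanced class has at least half of the average size n/t, and n/t is at least `200 * H`.
  large-arith : ∀ t′ n H s → 200 * (suc t′ * H) ≤ n → 100 * n ≤ 100 * (suc t′ * s) + n → 100 * H ≤ s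
  large-arith t′ n H s big h = *-cancelˡ-≤ t (*-cancelˡ-≤ 2 (begin
    2 * (t * (100 * H))    ≡⟨ l₁ t H ⟩
    200 * (t * H)          ≤⟨ big ⟩
    n                      ≤⟨ *-cancelˡ-≤ 50 (+-cancelʳ-≤ n (50 * n) (50 * (2 * (t * s))) half) ⟩
    2 * (t * s)            ∎))
    where
    open ≤-Reasoning
    t = suc t′
    l₁ : ∀ t h → 2 * (t * (100 * h)) ≡ 200 * (t * h)
    l₁ = solve-∀
    half : 50 * n + n ≤ 50 * (2 * (t * s)) + n
    half = begin
      50 * n + n               ≡⟨ +-comm (50 * n) n ⟩
      51 * n                   ≤⟨ *-monoˡ-≤ n (m≤m+n 51 49) ⟩
      100 * n                  ≤⟨ h ⟩
      100 * (t * s) + n        ≡⟨ cong (_+ n) (*-assoc 50 2 (t * s)) ⟩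
      50 * (2 * (t * s)) + n   ∎

  module _ {n t′ : ℕ} (G : Graph n) (lev : Leveled (2 * suc t′ ∸ 1) G)
    (part : Fin n → Maybe (Fin (suc t′))) (C : ℕ) (∣X∣≤C : countB (inX part) ≤ C)
    (dense : ∀ v i j → part v ≡ just i → i ≢ j →
      60 * suc t′ * nonNbrs G (inS part j) v ≤ countB (inS part j))
    (K : ℕ) (K-bound : 2 * suc C ^ (2 * suc t′) ≤ K)
    (n-large : 200 * (suc t′ * suc (C + K)) ≤ n)
    (balanced : ∀ j → 100 * n ≤ 100 * (suc t′ * countB (inS part j)) + n)
    where

    private
      t = suc t′

    large : ∀ j → 10 * suc (C + K) ≤ countB (inS part j)
    large j = ≤-trans (*-monoˡ-≤ (suc (C + K)) (m≤m+n 10 90))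
      (large-arith t′ n (suc (C + K)) (countB (inS part j)) n-large (balanced j))

    open Structure G lev part C ∣X∣≤C dense K K-bound large using (Near; near-own; near-high; no-claw)

    Low : Fin n → Set
    Low v = t * countB (adj G v) + t * C ≤ t′ * n

    -- Vertices of a class stay there. A vertex of `X` is assigned a class by `near-high` if its
    -- degree is high, and otherwise remains with the deficit `C` that the counting requires.
    classify : ∀ v → (∃ λ i → Near i v) ⊎ (Low v × inX part v ≡ true)
    classify v = by-part (part v) refl
      where
      by-part : ∀ w → part v ≡ w → (∃ λ i → Near i v) ⊎ (Low v × inX part v ≡ true)
      by-part (just i) eq = inj₁ (i , near-own eq)
      by-part nothing  eq with t′ * n ≤? t * countB (adj G v) + t * C
      ... | yes high = inj₁ (near-high balanced
              (≤-trans (*-monoʳ-≤ 200 (*-monoʳ-≤ t (n≤1+n (C + K)))) n-large) v high)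
      ... | no ¬high = inj₂ (<⇒≤ (≰⇒> ¬high) , inX-nothing G part eq)

    -- `Near` is still measured against the original classes, so `no-claw` applies to all members of
    -- a new class, including those moved out of `X`.
    refined : Fin n → Maybe (Fin t)
    refined v with classify v
    ... | inj₁ (i , _) = just i
    ... | inj₂ _       = nothing

    refined-just : ∀ {v i} → refined v ≡ just i → Near i v
    refined-just {v} eq with classify v
    refined-just refl | inj₁ (i , near) = near

    refined-nothing : ∀ v → refined v ≡ nothing → Low v
    refined-nothing v eq with classify v
    ... | inj₂ (low , _) = low

    inX-refined : ∀ v → inX refined v ≡ true → inX part v ≡ true
    inX-refined v eq with classify v
    ... | inj₂ (_ , x) = x

    edges≤ : 2 * t * numEdges G ≤ t′ * n * n + 2 * t * n
    edges≤ = edge-bound G refined (≤-trans (count-mono inX-refined) ∣X∣≤C)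
      (λ u i eq → count≤2 (λ v → adj G u v ∧ inS refined i v) λ a b c a≢b a≢c b≢c pa pb pc →
        no-claw i (refined-just eq) (near a i u pa) (near b i u pb) (near c i u pc) a≢b a≢c b≢c
          (∧-conicalˡ _ _ pa) (∧-conicalˡ _ _ pb) (∧-conicalˡ _ _ pc))
      refined-nothing
      where
      near : ∀ v i u → adj G u v ∧ inS refined i v ≡ true → Near i v
      near v i u p = refined-just (inS⁻ refined i v (∧-conicalʳ (adj G u v) _ p))

open Combinatorics
open import Data.Integer using (+_)
open import Data.Rational using (ℚ; _/_; _-_; _+_; _*_; _≤_; 1ℚ)
open import Data.Bool.Properties using (∧-comm)
open import Data.Rational.Solver using (module +-*-Solver)
import Data.Nat.Properties as ℕ
import Data.Integer as ℤ
import Data.Integer.Properties as ℤ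
import Data.Rational as ℚ
import Data.Rational.Properties as ℚ
import Data.Rational.Unnormalised as ℚᵘ
import Data.Rational.Unnormalised.Properties as ℚᵘ

-- Passing from rational hypotheses to inequalities between natural numbers.

toℚᵘ-⟦⟧ : ∀ a → ℚ.toℚᵘ ⟦ a ⟧ ℚᵘ.≃ ℚᵘ.mkℚᵘ (+ a) 0
toℚᵘ-⟦⟧ a = ℚ.toℚᵘ-fromℚᵘ (ℚᵘ.mkℚᵘ (+ a) 0)

⟦⟧-+ : ∀ a b → ⟦ a ℕ.+ b ⟧ ≡ ⟦ a ⟧ + ⟦ b ⟧
⟦⟧-+ a b = ℚ.toℚᵘ-injective (begin
  ℚ.toℚᵘ ⟦ a ℕ.+ b ⟧
    ≈⟨ toℚᵘ-⟦⟧ (a ℕ.+ b) ⟩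
  ℚᵘ.mkℚᵘ (+ (a ℕ.+ b)) 0
    ≡⟨ cong₂ (λ x y → ℚᵘ.mkℚᵘ (x ℤ.+ y) 0) (ℤ.*-identityʳ (+ a)) (ℤ.*-identityʳ (+ b)) ⟨
  ℚᵘ.mkℚᵘ (+ a) 0 ℚᵘ.+ ℚᵘ.mkℚᵘ (+ b) 0
    ≈⟨ ℚᵘ.+-cong (toℚᵘ-⟦⟧ a) (toℚᵘ-⟦⟧ b) ⟨
  ℚ.toℚᵘ ⟦ a ⟧ ℚᵘ.+ ℚ.toℚᵘ ⟦ b ⟧
    ≈⟨ ℚ.toℚᵘ-homo-+ ⟦ a ⟧ ⟦ b ⟧ ⟨
  ℚ.toℚᵘ (⟦ a ⟧ + ⟦ b ⟧) ∎)
  where open ℚᵘ.≃-Reasoning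

⟦⟧-* : ∀ a b → ⟦ a ℕ.* b ⟧ ≡ ⟦ a ⟧ * ⟦ b ⟧
⟦⟧-* a b = ℚ.toℚᵘ-injective (begin
  ℚ.toℚᵘ ⟦ a ℕ.* b ⟧
    ≈⟨ toℚᵘ-⟦⟧ (a ℕ.* b) ⟩
  ℚᵘ.mkℚᵘ (+ (a ℕ.* b)) 0
    ≡⟨ cong (λ x → ℚᵘ.mkℚᵘ x 0) (ℤ.pos-* a b) ⟩
  ℚᵘ.mkℚᵘ (+ a) 0 ℚᵘ.* ℚᵘ.mkℚᵘ (+ b) 0
    ≈⟨ ℚᵘ.*-cong (toℚᵘ-⟦⟧ a) (toℚᵘ-⟦⟧ b) ⟨
  ℚ.toℚᵘ ⟦ a ⟧ ℚᵘ.* ℚ.toℚᵘ ⟦ b ⟧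
    ≈⟨ ℚ.toℚᵘ-homo-* ⟦ a ⟧ ⟦ b ⟧ ⟨
  ℚ.toℚᵘ (⟦ a ⟧ * ⟦ b ⟧) ∎)
  where open ℚᵘ.≃-Reasoning

⟦⟧-cancel-≤ : ∀ {a b} → ⟦ a ⟧ ≤ ⟦ b ⟧ → a ℕ.≤ b
⟦⟧-cancel-≤ {a} {b} h with ℚᵘ.≤-respˡ-≃ (toℚᵘ-⟦⟧ a) (ℚᵘ.≤-respʳ-≃ (toℚᵘ-⟦⟧ b) (ℚ.toℚᵘ-mono-≤ h))
... | ℚᵘ.*≤* p = ℤ.drop‿+≤+ (subst₂ ℤ._≤_ (ℤ.*-identityʳ (+ a)) (ℤ.*-identityʳ (+ b)) p)

⟦⟧-mono-≤ : ∀ {a b} → a ℕ.≤ b → ⟦ a ⟧ ≤ ⟦ b ⟧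
⟦⟧-mono-≤ {a} {b} h = ℚ.toℚᵘ-cancel-≤
  (ℚᵘ.≤-respˡ-≃ (ℚᵘ.≃-sym (toℚᵘ-⟦⟧ a)) (ℚᵘ.≤-respʳ-≃ (ℚᵘ.≃-sym (toℚᵘ-⟦⟧ b))
    (ℚᵘ.*≤* (subst₂ ℤ._≤_ (sym (ℤ.*-identityʳ (+ a))) (sym (ℤ.*-identityʳ (+ b))) (ℤ.+≤+ h)))))

⟦⟧-nonNeg : ∀ a → ℚ.NonNegative ⟦ a ⟧
⟦⟧-nonNeg a = ℚ.nonNegative (⟦⟧-mono-≤ {0} {a} ℕ.z≤n)

-- Write `k * a` as `k * (a * (1 − ε)) + a * (ε * k)` and bound the two terms by `k * b` and `a`.
clear-ε : ∀ k a b ε → ε * ⟦ k ⟧ ≤ 1ℚ → ⟦ a ⟧ * (1ℚ - ε) ≤ ⟦ b ⟧ → k ℕ.* a ℕ.≤ k ℕ.* b ℕ.+ a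
clear-ε k a b ε small h = ⟦⟧-cancel-≤ (begin
  ⟦ k ℕ.* a ⟧
    ≡⟨ ⟦⟧-* k a ⟩
  ⟦ k ⟧ * ⟦ a ⟧
    ≡⟨ expand ⟦ k ⟧ ⟦ a ⟧ ε ⟩
  ⟦ k ⟧ * (⟦ a ⟧ * (1ℚ - ε)) + ⟦ a ⟧ * (ε * ⟦ k ⟧)
    ≤⟨ ℚ.+-mono-≤ (ℚ.*-monoˡ-≤-nonNeg ⟦ k ⟧ {{⟦⟧-nonNeg k}} h) (ℚ.*-monoˡ-≤-nonNeg ⟦ a ⟧ {{⟦⟧-nonNeg a}} small) ⟩
  ⟦ k ⟧ * ⟦ b ⟧ + ⟦ a ⟧ * 1ℚ
    ≡⟨ cong₂ _+_ (sym (⟦⟧-* k b)) (ℚ.*-identityʳ ⟦ a ⟧) ⟩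
  ⟦ k ℕ.* b ⟧ + ⟦ a ⟧
    ≡⟨ ⟦⟧-+ (k ℕ.* b) a ⟨
  ⟦ k ℕ.* b ℕ.+ a ⟧ ∎)
  where
  open ℚ.≤-Reasoning
  expand : ∀ k a e → k * a ≡ k * (a * (1ℚ - e)) + a * (e * k)
  expand = solve 3 (λ k a e → k :* a := k :* (a :* (con 1ℚ :- e)) :+ a :* (e :* k)) refl
    where open +-*-Solver

few-nonNbrs : ∀ {n} (G : Graph n) v S k ε → ε * ⟦ k ⟧ ≤ 1ℚ →
  ⟦ countB S ⟧ * (1ℚ - ε) ≤ ⟦ deg G v S ⟧ → k ℕ.* nonNbrs G S v ℕ.≤ countB S
few-nonNbrs G v S k ε small h = split-arith k (countB S) (deg G v S) (nonNbrs G S v)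
  (trans (cong (ℕ._+ nonNbrs G S v) deg≡) (count-∧-not S (adj G v)))
  (clear-ε k (countB S) (deg G v S) ε small h)
  where
  deg≡ : deg G v S ≡ countB (λ u → S u ∧ adj G v u)
  deg≡ = ℕ.≤-antisym (count-mono λ u p → trans (∧-comm (S u) (adj G v u)) p)
    (count-mono λ u p → trans (∧-comm (adj G v u) (S u)) p)

theorem3p4 : (η α : ℕ → ℚ) → ConstantsOK η α →
    (t : ℕ) → 1 ℕ.≤ t → (C : ℕ) →
    ∃[ n₀ ] ((n : ℕ) → n₀ ℕ.≤ n → (G : Graph n) → (part : Fin n → Maybe (Fin t)) →
    (∀ v i j → part v ≡ just i → i ≢ j →
    ⟦ countB (inS part j) ⟧ * (1ℚ - η t * (+ 1 / 12)) ≤ ⟦ deg G v (inS part j) ⟧) →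
    countB (inX part) ℕ.≤ C →
    (∀ i → (⟦ n ⟧ * (1ℚ - α t) ≤ ⟦ t ℕ.* countB (inS part i) ⟧)
    × (⟦ t ℕ.* countB (inS part i) ⟧ ≤ ⟦ n ⟧ * (1ℚ + α t))) →
    Leveled (2 ℕ.* t ℕ.∸ 1) G →
    2 ℕ.* t ℕ.* numEdges G ℕ.≤ (t ℕ.∸ 1) ℕ.* n ℕ.* n ℕ.+ 2 ℕ.* t ℕ.* n)
theorem3p4 η α (ok , _) t@(ℕ.suc t′) 1≤t C =
  -- This threshold makes every class larger than `100 * suc (C + K)` or equal to it, by
  -- `large-arith`.
  200 ℕ.* (t ℕ.* ℕ.suc (C ℕ.+ K)) , λ n n-large G part dense ∣X∣≤C balanced lev →
  edges≤ G lev part C ∣X∣≤C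
    -- The hypothesis yields the factor `100 * t`, more than the `60 * t` that the structural part
    -- works with.
    (λ v i j eq ne → ℕ.≤-trans (ℕ.*-monoˡ-≤ (nonNbrs G (inS part j) v) (ℕ.*-monoˡ-≤ t (ℕ.m≤m+n 60 40)))
      (few-nonNbrs G v (inS part j) (100 ℕ.* t) (η t * (+ 1 / 12)) η/12-small (dense v i j eq ne)))
    K ℕ.≤-refl n-large
    (λ j → clear-ε 100 n (t ℕ.* countB (inS part j)) (α t) α-small (proj₁ (balanced j)))
  where
  open ℚ.≤-Reasoning
  K = 2 ℕ.* ℕ.suc C ℕ.^ (2 ℕ.* t)
  0<η = proj₁ (ok t 1≤t)
  η-bound = proj₁ (proj₂ (ok t 1≤t))
  0<α = proj₁ (proj₂ (proj₂ (ok t 1≤t)))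
  α-bound = proj₂ (proj₂ (proj₂ (ok t 1≤t)))
  instance
    η-nonNeg : ℚ.NonNegative (η t)
    η-nonNeg = ℚ.nonNegative (ℚ.<⇒≤ 0<η)
    α-nonNeg : ℚ.NonNegative (α t)
    α-nonNeg = ℚ.nonNegative (ℚ.<⇒≤ 0<α)
  α≤η : α t ≤ η t
  α≤η = begin
    α t                ≡⟨ ℚ.*-identityʳ (α t) ⟨
    α t * 1ℚ           ≤⟨ ℚ.*-monoˡ-≤-nonNeg (α t) (⟦⟧-mono-≤ {1} {10 ℕ.* t} (ℕ.*-mono-≤ {1} {10} (ℕ.s≤s ℕ.z≤n) 1≤t)) ⟩
    α t * ⟦ 10 ℕ.* t ⟧ ≤⟨ ℚ.<⇒≤ α-bound ⟩
    η t                ∎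
  -- Balance up to one part in 100 comes from the bound on `η t`, through `α t ≤ η t` and
  -- `100 ≤ 100 * t`.
  α-small : α t * ⟦ 100 ⟧ ≤ 1ℚ
  α-small = begin
    α t * ⟦ 100 ⟧       ≤⟨ ℚ.*-monoʳ-≤-nonNeg ⟦ 100 ⟧ {{⟦⟧-nonNeg 100}} α≤η ⟩
    η t * ⟦ 100 ⟧       ≤⟨ ℚ.*-monoˡ-≤-nonNeg (η t) (⟦⟧-mono-≤ {100} {100 ℕ.* t} (ℕ.m≤m*n 100 t)) ⟩
    η t * ⟦ 100 ℕ.* t ⟧ ≤⟨ ℚ.<⇒≤ η-bound ⟩
    1ℚ                  ∎
  η/12-small : η t * (+ 1 / 12) * ⟦ 100 ℕ.* t ⟧ ≤ 1ℚ
  η/12-small = begin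
    η t * (+ 1 / 12) * ⟦ 100 ℕ.* t ⟧
      -- The factor 1/12 is bounded by 1, and `η t` by 1/(100t).
      ≤⟨ ℚ.*-monoʳ-≤-nonNeg ⟦ 100 ℕ.* t ⟧ {{⟦⟧-nonNeg (100 ℕ.* t)}} (ℚ.*-monoˡ-≤-nonNeg (η t) (ℚ.≤ᵇ⇒≤ _)) ⟩
    η t * 1ℚ * ⟦ 100 ℕ.* t ⟧
      ≡⟨ cong (_* ⟦ 100 ℕ.* t ⟧) (ℚ.*-identityʳ (η t)) ⟩
    η t * ⟦ 100 ℕ.* t ⟧
      ≤⟨ ℚ.<⇒≤ η-bound ⟩
    1ℚ ∎
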